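{- Let $q$ be a prime power, $r\ge 1$ an integer and $v\ge 2$. If $\mathcal{C}$ is a $q^r$-divisible set of points of $\mathrm{PG}(v-1,q)$ with $n=|\mathcal{C}|$, then $$n\notin\left[(a(q-1)+b)\begin{bmatrix}r+1\\1\end{bmatrix}_q+a+1,\ (a(q-1)+b+1)\begin{bmatrix}r+1\\1\end{bmatrix}_q-1\right]$$ for all integers $a,b\ge 0$ with $b\le q-2$ and $a\le r-1$. Moreover, every integer $n$ with $0\le n\le rq^{r+1}$ that does not lie in any of these intervals is the cardinality of some $q^r$-divisible set of points in $\mathrm{PG}(v-1,q)$ for some $v\ge 2$.
   Context: $\mathrm{PG}(v-1,q)$ denotes the set of $1$-dimensional subspaces (points) of $\mathbb{F}_q^v$; hyperplanes are the $(v-1)$-dimensional subspaces of $\mathbb{F}_q^v$. For $k\ge 1$, $\begin{bmatrix}k\\1\end{bmatrix}_q=\frac{q^k-1}{q-1}$. A set $\mathcal{C}$ of points of $\mathrm{PG}(v-1,q)$ is called $\Delta$-divisible (for an integer $\Delta\ge1$) if there is an integer $u$ such that $|\mathcal{C}\cap H|\equiv u\pmod{\Delta}$ for every hyperplane $H$, where $\mathcal{C}\cap H$ denotes the set of points of $\mathcal{C}$ contained in $H$. For integers $x\le y$, $[x,y]$ denotes $\{x,x+1,\dots,y\}$.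
   Formalization: In the first part the case where v ≤ r and C is the set of all points of PG(v-1,q) is excluded: there C is q^r-divisible as defined, yet n lies in the interval for a=b=0 (e.g. q=2, r=2, v=2, n=3). -}

module Defs where

open import Level using (_⊔_) renaming (suc to lsuc)
open import Algebra.Apartness.Bundles using (HeytingField; HeytingCommutativeRing)
open import Algebra.Bundles using (CommutativeRing)
import Algebra.Properties.Monoid.Sum as MonoidSum
open import Data.Fin.Base using (Fin)
open import Data.Integer.Base using (ℤ; +_) renaming (_-_ to _-ℤ_)
open import Data.Integer.Divisibility using () renaming (_∣_ to _∣ℤ_)
open import Data.Nat.Base
  using (ℕ; suc; _+_; _*_; _∸_; _^_; _/_; _≤_; _<_; NonZero; >-nonZero; nonTrivial⇒n>1)
open import Data.Nat.Primality using (Prime; prime⇒nonTrivial)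
open import Data.Nat.Properties using (m<n⇒0<n∸m; <-≤-trans; m≤m*n; m^n≢0)
open import Data.Product.Base using (Σ; ∃; _×_; _,_; proj₁; proj₂)
open import Data.Vec.Functional using (Vector; replicate; zipWith; map)
import Data.Vec.Functional.Relation.Binary.Equality.Setoid as VecEq
open import Function.Bundles using (Inverse)
open import Relation.Binary.Bundles using (Setoid)
import Relation.Binary.Construct.On as On
open import Relation.Binary.Definitions using (_Respects_)
open import Relation.Binary.PropositionalEquality as ≡ using (_≡_)
open import Relation.Unary using (Pred; _⊆_)
open import Relation.Unary.Relation.Binary.Equality using (≐-setoid)

HasCardinality : ∀ {a ℓ} → Setoid a ℓ → ℕ → Set (a ⊔ ℓ)
HasCardinality S n = Inverse S (≡.setoid (Fin n))

record PrimePower (q : ℕ) : Set where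
  field
    p k     : ℕ
    isPrime : Prime p
    1≤k     : 1 ≤ k
    q≡p^k   : q ≡ p ^ k

-- On a carrier in bijection with some Fin q equality is decidable and x # y
-- amounts to ¬ (x ≈ y), so that a finite Heyting field is a finite field in
-- the usual sense.
record FiniteField c ℓ ℓ# (q : ℕ) : Set (lsuc (c ⊔ ℓ ⊔ ℓ#)) where
  field
    heytingField : HeytingField c ℓ ℓ#

  open HeytingField heytingField using (heytingCommutativeRing)

  commutativeRing : CommutativeRing c ℓ
  commutativeRing = HeytingCommutativeRing.commutativeRing heytingCommutativeRing

  open CommutativeRing commutativeRing public

  field
    order : HasCardinality setoid q

private
  1<p^k : ∀ {p k} → 1 < p → 1 ≤ k → 1 < p ^ k
  1<p^k {p@(suc _)} {suc k} 1<p _ =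
    <-≤-trans 1<p (m≤m*n p (p ^ k) {{m^n≢0 p k}})

primePower⇒1<q : ∀ {q} → PrimePower q → 1 < q
primePower⇒1<q record { isPrime = isPrime ; 1≤k = 1≤k ; q≡p^k = ≡.refl } =
  1<p^k (nonTrivial⇒n>1 _ {{prime⇒nonTrivial isPrime}}) 1≤k

instance
  primePower⇒nonZero : ∀ {q} → {{PrimePower q}} → NonZero (q ∸ 1)
  primePower⇒nonZero {{pp}} = >-nonZero (m<n⇒0<n∸m (primePower⇒1<q pp))

-- The division is exact.
[_,1]_ : (k q : ℕ) → .{{NonZero (q ∸ 1)}} → ℕ
[ k ,1] q = (q ^ k ∸ 1) / (q ∸ 1)

infix 4 _∈[_,_]

_∈[_,_] : ℕ → ℕ → ℕ → Set
n ∈[ x , y ] = x ≤ n × n ≤ y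

module PG {c ℓ ℓ# q} (F : FiniteField c ℓ ℓ# q) (v : ℕ) where

  private module F = FiniteField F
  open MonoidSum F.+-monoid using (sum)
  open VecEq F.setoid using (_≋_)

  V : Set c
  V = Vector F.Carrier v

  0ᵥ : V
  0ᵥ = replicate v F.0#

  infixl 6 _+ᵥ_
  infixr 7 _·ᵥ_

  _+ᵥ_ : V → V → V
  _+ᵥ_ = zipWith F._+_

  _·ᵥ_ : F.Carrier → V → V
  a ·ᵥ x = map (a F.*_) x

  linComb : ∀ {k} → Vector F.Carrier k → Vector V k → V
  linComb a b j = sum (λ i → a i F.* b i j)

  record Subspace : Set (lsuc (c ⊔ ℓ)) where
    field
      Mem      : Pred V (c ⊔ ℓ)
      resp     : Mem Respects _≋_
      0-mem    : Mem 0ᵥ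
      +-closed : ∀ {x y} → Mem x → Mem y → Mem (x +ᵥ y)
      ·-closed : ∀ a {x} → Mem x → Mem (a ·ᵥ x)

  open Subspace public using (Mem)

  record HasDimension (W : Subspace) (k : ℕ) : Set (c ⊔ ℓ) where
    field
      basis       : Vector V k
      basis-mem   : ∀ i → Mem W (basis i)
      independent : ∀ a → linComb a basis ≋ 0ᵥ → ∀ i → a i F.≈ F.0#
      spanning    : ∀ {x} → Mem W x → ∃ λ a → x ≋ linComb a basis

  Point : Set (lsuc (c ⊔ ℓ))
  Point = Σ Subspace λ W → HasDimension W 1

  Hyperplane : Set (lsuc (c ⊔ ℓ))
  Hyperplane = Σ Subspace λ W → HasDimension W (v ∸ 1)

  -- Points are equal when they have the same vectors; the chosen basis
  -- does not matter.
  pointSetoid : Setoid (lsuc (c ⊔ ℓ)) (c ⊔ ℓ)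
  pointSetoid = On.setoid {B = Point} (≐-setoid V (c ⊔ ℓ)) (λ P → Mem (proj₁ P))

  open Setoid pointSetoid public using () renaming (_≈_ to _≈ₚ_)

  record PointSet : Set (lsuc (c ⊔ ℓ)) where
    field
      Has  : Pred Point (c ⊔ ℓ)
      resp : Has Respects _≈ₚ_

  open PointSet public using (Has)

  ∣_∣≡_ : PointSet → ℕ → Set (lsuc (c ⊔ ℓ))
  ∣ C ∣≡ n = HasCardinality (On.setoid {B = Σ Point (Has C)} pointSetoid proj₁) n

  _∩_ : PointSet → Hyperplane → PointSet
  C ∩ (H , _) = record
    { Has  = λ P → Has C P × Mem (proj₁ P) ⊆ Mem H
    ; resp = λ { P≈Q (P∈C , P⊆H) →
                 PointSet.resp C P≈Q P∈C , λ x∈Q → P⊆H (proj₂ P≈Q x∈Q) }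
    }

  Divisible : ℕ → PointSet → Set (lsuc (c ⊔ ℓ))
  Divisible Δ C = ∃ λ (u : ℤ) → ∀ (H : Hyperplane) →
    ∃ λ m → (∣ C ∩ H ∣≡ m) × (+ Δ) ∣ℤ (+ m -ℤ u)

  -- In V of dimension v, every hyperplane meets the whole space in [ v ∸ 1 ,1] q
  -- points, so the whole space is Δ-divisible for every Δ. When 2 ≤ v ≤ r its
  -- cardinality [ v ,1] q is below [ r + 1 ,1] q and so lies in the first
  -- excluded interval: this one set must be exempted there.
  IsWholeSpace : PointSet → Set (lsuc (c ⊔ ℓ))
  IsWholeSpace C = ∀ P → Has C P

{-# OPTIONS --safe #-}
module Submission where

-- Write q = K + 1, Q = [r+1,1] and N = a K + b. The weight of a vector h is the
-- number of points of C off the hyperplane orthogonal to h. For a q^r-divisible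
-- C all weights are multiples t q^r, and C ∩ H is q^(r-1)-divisible, as one sees
-- by summing the weights over a pencil g + λ h. Let n = N Q + a + 1 + y lie in a
-- forbidden interval. If y ≤ a, the average weight exceeds N q^r, so some
-- hyperplane section has size n - t q^r with t > N, which is negative or in a
-- forbidden interval for r - 1. If y > a, summing (t - N)(t - N - 1) ≥ 0 over all
-- h contradicts the first two moments of the weight, which are determined by n
-- because distinct points are independent.
--
-- Conversely, since q^(r+1) = K Q + 1, a cardinality n ≤ r q^(r+1) outside the
-- intervals has the form A Q + B q^(r+1), and is realised in a direct sum of A
-- projective and B affine spaces.

open import Algebra.Apartness.Bundles using (HeytingField)
open import Algebra.Bundles using (Monoid)
import Algebra.Properties.CommutativeSemigroup as CSG
import Algebra.Properties.Monoid.Sum as MonoidSum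
import Algebra.Properties.Ring as RingProps
import Algebra.Properties.Semiring.Sum as SemiringSum
open import Data.Empty using (⊥)
open import Data.Fin.Base using (Fin; zero; suc; combine; punchIn; punchOut; splitAt; _↑ˡ_; _↑ʳ_; funToFin; finToFun)
open import Data.Fin.Permutation using (Permutation; permutation)
import Data.Fin.Properties as Fin
open import Data.Integer.Base using () renaming (+_ to ⁺_; _-_ to _-ℤ_; _+_ to _+ℤ_; -_ to -ℤ_; ∣_∣ to ∣_∣ℤ)
open import Data.Integer.Divisibility using () renaming (_∣_ to _∣ℤ_)
import Data.Integer.Divisibility.Signed as Signed
import Data.Integer.Properties as ℤ
import Data.Integer.Tactic.RingSolver as ℤSolver
open import Data.Nat.Base
open import Data.Nat.DivMod hiding (_div_)
open import Data.Nat.Divisibility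
open import Data.Nat.Properties
open import Data.Nat.Tactic.RingSolver using (solve-∀)
open import Data.Product.Base using (Σ; _,_; _×_; ∃; proj₁; proj₂)
open import Data.Sum.Base using (_⊎_; inj₁; inj₂; [_,_]′)
open import Data.Unit.Base using (tt)
open import Data.Vec.Functional using (Vector; removeAt; _∷_; _++_; tail)
import Data.Vec.Functional.Properties as VecF
open import Defs
open import Function.Base using (_∘_)
open import Function.Bundles using (Inverse; Injection)
open import Function.Properties.Inverse using (Inverse⇒Injection)
open import Level using (Level; Lift; lift; lower) renaming (_⊔_ to _⊔ˡ_)
open import Relation.Binary.PropositionalEquality using (_≡_; _≢_; refl; sym; trans; cong; cong₂; subst; subst₂; module ≡-Reasoning)
import Relation.Binary.Reasoning.Setoid as SetoidReasoning
open import Relation.Nullary using (¬_; Dec; yes; no; contradiction; ¬?)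
open import Relation.Nullary.Decidable using (map′; decidable-stable)

open SemiringSum +-*-semiring
  renaming (sum to ∑; sum-cong-≗ to ∑-cong; sum-remove to ∑-remove; sum-permute to ∑-permutation;
            *-distribˡ-sum to *-distribˡ-∑; *-distribʳ-sum to *-distribʳ-∑)
  using (∑-comm; ∑-distrib-+)

-- Arithmetic of the excluded intervals

-- Origin of N and of the two cases: over all h, the zero vector included, t has average K n /
-- q^(r+1) = N + U / q^(r+1) with U = K (y + 1) - b, strictly between N and N + 1. The quadratic
-- inequality amounts to U W ≤ N q^(r+1), where U + W + 1 = q^(r+1). It is refuted once U and W both
-- exceed N. The upper end of the interval ensures this for W, and y > a ensures it for U. For y ≤ a
-- the number U can be too small, and only the average is used. The descent then stays among the
-- intervals because Q = q^r + [r,1] and q^r = K [r,1] + 1: a section with t = N + s replaces a by a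
-- - s and keeps b and y. An obstacle precedes all this. Divisibility only gives the section sizes a
-- common residue. That the weights are multiples of q^r follows from the first moment if the
-- dimension exceeds r. In smaller dimension a nonempty C turns out to be the whole space, the
-- exempted case. Sums run over vectors h rather than over hyperplanes because translations permute
-- the vectors, so that every count reduces to an affine function on a line.

m+o≡n⇒m≤n : ∀ {m n} o → m + o ≡ n → m ≤ n
m+o≡n⇒m≤n {m} o refl = m≤m+n m o

-- The Gaussian number [k,1] for q = K + 1.
geo : ℕ → ℕ → ℕ
geo K zero    = 0
geo K (suc k) = suc K ^ k + geo K k

pow-geo : ∀ K k → suc K ^ k ≡ 1 + K * geo K k
pow-geo K zero    = cong suc (sym (*-zeroʳ K))
pow-geo K (suc k) = begin
  suc K ^ k + K * suc K ^ k              ≡⟨ cong (_+ K * suc K ^ k) (pow-geo K k) ⟩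
  1 + K * geo K k + K * suc K ^ k        ≡⟨ lem K (geo K k) (suc K ^ k) ⟩
  1 + K * (suc K ^ k + geo K k)          ∎
  where
  open ≡-Reasoning
  lem : ∀ K g p → 1 + K * g + K * p ≡ 1 + K * (p + g)
  lem = solve-∀

2j+1≤geo : ∀ K j → suc (j + j) ≤ geo (suc K) (suc j)
2j+1≤geo K zero    = ≤-refl
2j+1≤geo K (suc j) = begin
  suc (suc j + suc j)                                  ≡⟨ cong (2 +_) (+-suc j j) ⟩
  2 + suc (j + j)                                      ≤⟨ +-mono-≤ 2≤pow (2j+1≤geo K j) ⟩
  suc (suc K) ^ suc j + geo (suc K) (suc j)            ∎
  where
  open ≤-Reasoning
  2≤pow : 2 ≤ suc (suc K) ^ suc j
  2≤pow = begin
    2                       ≤⟨ s≤s (s≤s z≤n) ⟩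
    suc (suc K)             ≤⟨ m≤m*n (suc (suc K)) (suc (suc K) ^ j) {{m^n≢0 (suc (suc K)) j}} ⟩
    suc (suc K) ^ suc j     ∎

-- Since N < (j + 1) K in the application, this yields (N + 1)(N + 2) < q^(j + 2), the bound that
-- refutes the moment inequality. The inductive step multiplies by q. From `j = 0` to `j = 1` it
-- would fail at q = 2, where 6 > 2 * 2, hence the two base cases. The next step is an equality
-- there.
quadratic<power : ∀ k j → (suc j * suc k) * suc (suc j * suc k) < suc (suc k) ^ (2 + j)
quadratic<power k zero          = m+o≡n⇒m≤n (suc k) (lem k)
  where
  lem : ∀ k → suc ((1 * suc k) * suc (1 * suc k)) + suc k ≡ suc (suc k) * (suc (suc k) * 1)
  lem = solve-∀
quadratic<power k (suc zero)    = m+o≡n⇒m≤n (1 + 2 * k + 2 * k * k + k * k * k) (lem k)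
  where
  lem : ∀ k → suc ((2 * suc k) * suc (2 * suc k)) + (1 + 2 * k + 2 * k * k + k * k * k)
            ≡ suc (suc k) * (suc (suc k) * (suc (suc k) * 1))
  lem = solve-∀
quadratic<power k (suc (suc j)) = begin-strict
  ((3 + j) * suc k) * suc ((3 + j) * suc k)             ≤⟨ m≤m+n _ _ ⟩
  ((3 + j) * suc k) * suc ((3 + j) * suc k) + suc k * slack k j
    ≡⟨ lem k j ⟩
  suc (suc k) * (((2 + j) * suc k) * suc ((2 + j) * suc k))
    <⟨ *-monoʳ-< (suc (suc k)) (quadratic<power k (suc j)) ⟩
  suc (suc k) ^ (4 + j)                                 ∎
  where
  open ≤-Reasoning
  slack : ℕ → ℕ → ℕ
  slack k j = 3 * j + j * j + k * (5 + 7 * j + 2 * j * j) + k * k * (4 + 4 * j + j * j)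
  lem : ∀ k j → ((3 + j) * suc k) * suc ((3 + j) * suc k)
                + suc k * (3 * j + j * j + k * (5 + 7 * j + 2 * j * j) + k * k * (4 + 4 * j + j * j))
              ≡ suc (suc k) * (((2 + j) * suc k) * suc ((2 + j) * suc k))
  lem = solve-∀

-- The interval with parameters a and b, y being the offset from its lower end.
record Gap (K r n : ℕ) : Set where
  constructor gap
  field
    a b y : ℕ
    a<r   : a < r
    b<K   : b < K
    n≡    : n ≡ (a * K + b) * geo K (suc r) + (a + 1 + y)
    y<    : a + 2 + y ≤ geo K (suc r)

-- With N = a K + b: if no weight exceeded N q^r then averaging would give
-- (q - 1) n ≤ N q^(r + 1).
average-exceeds : ∀ {K a b} y Q → b < K →
                  ¬ (K * ((a * K + b) * Q + (a + 1 + y)) ≤ (1 + K * Q) * (a * K + b))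
average-exceeds {K} {a} {b} y Q b<K le = <-irrefl refl (begin-strict
  a * K + b           <⟨ +-monoʳ-< (a * K) b<K ⟩
  a * K + K           ≤⟨ m≤m+n _ _ ⟩
  a * K + K + K * y   ≡⟨ e₁ K a y ⟩
  K * (a + 1 + y)     ≤⟨ +-cancelˡ-≤ (K * Q * (a * K + b)) _ _ le′ ⟩
  a * K + b           ∎)
  where
  open ≤-Reasoning
  e₁ : ∀ K a y → a * K + K + K * y ≡ K * (a + 1 + y)
  e₁ = solve-∀
  e₂ : ∀ K N Q z → K * (N * Q + z) ≡ K * Q * N + K * z
  e₂ = solve-∀
  e₃ : ∀ K N Q → (1 + K * Q) * N ≡ K * Q * N + N
  e₃ = solve-∀
  le′ : K * Q * (a * K + b) + K * (a + 1 + y) ≤ K * Q * (a * K + b) + (a * K + b)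
  le′ = subst₂ _≤_ (e₂ K (a * K + b) Q (a + 1 + y)) (e₃ K (a * K + b) Q) le

-- With D = q^(r + 1) and `Q = geo K (suc r)`, one has `geo K (2 + r)` = D + Q and D = 1 + K Q.
-- Removing N + s copies of D, where s = `suc σ`, therefore turns a into a - s and leaves b and y
-- alone. The new interval is shorter, but y ≤ a ≤ r keeps the offset inside it.
gap-descends : ∀ {K r a b y m} σ → a < suc r → b < K → y ≤ a →
               m + suc K ^ suc r * (a * K + b + suc σ)
                 ≡ (a * K + b) * geo K (2 + r) + (a + 1 + y) →
               Gap K r m
gap-descends {suc k} {r} {a} {b} {y} {m} σ (s≤s a≤r) b<K y≤a eq = go (suc σ ≤? a)
  where
  K = suc k
  Q = geo K (suc r)

  2r+1≤Q : suc (r + r) ≤ Q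
  2r+1≤Q = 2j+1≤geo k r

  e₁ : ∀ D m N s → m + D * (N + s) ≡ m + D * s + N * D
  e₁ = solve-∀
  e₂ : ∀ D Q N z → N * (D + Q) + z ≡ N * Q + z + N * D
  e₂ = solve-∀
  eq′ : m + (1 + K * Q) * suc σ ≡ (a * K + b) * Q + (a + 1 + y)
  eq′ = subst (λ D → m + D * suc σ ≡ (a * K + b) * Q + (a + 1 + y)) (pow-geo K (suc r))
          (+-cancelʳ-≡ ((a * K + b) * suc K ^ suc r) _ _
            (trans (sym (e₁ (suc K ^ suc r) m (a * K + b) (suc σ)))
              (trans eq (e₂ (suc K ^ suc r) Q (a * K + b) (a + 1 + y)))))

  go : _ → Gap K r m
  go (yes σ<a) with a′ , refl ← m≤n⇒∃[o]m+o≡n σ<a =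
    gap a′ b y (≤-trans (s≤s (m≤n+m a′ σ)) a≤r) b<K
      (+-cancelʳ-≡ ((1 + K * Q) * suc σ) _ _ (trans eq′ (e₃ a′ (suc σ) K b Q y)))
      bound
    where
    e₃ : ∀ a s K b Q y → ((s + a) * K + b) * Q + (s + a + 1 + y)
                       ≡ (a * K + b) * Q + (a + 1 + y) + (1 + K * Q) * s
    e₃ = solve-∀
    e₄ : ∀ a y → a + 2 + y ≡ suc (suc a + y)
    e₄ = solve-∀
    bound : a′ + 2 + y ≤ Q
    bound = begin
      a′ + 2 + y              ≡⟨ e₄ a′ y ⟩
      suc (suc a′ + y)        ≤⟨ s≤s (+-mono-≤ (≤-trans (s≤s (m≤n+m a′ σ)) a≤r) (≤-trans y≤a a≤r)) ⟩
      suc (r + r)             ≤⟨ 2r+1≤Q ⟩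
      Q                       ∎
      where open ≤-Reasoning
  -- For s > a the section size `m` would be negative: the equation forces Q ≤ y, whereas y ≤ r < Q.
  go (no σ≮a) with τ , refl ← m≤n⇒∃[o]m+o≡n (s≤s⁻¹ (≰⇒> σ≮a)) | c , refl ← m≤n⇒∃[o]m+o≡n b<K =
    contradiction Q≤y (<⇒≱ (begin-strict
      y            ≤⟨ ≤-trans y≤a a≤r ⟩
      r            <⟨ s≤s (m≤m+n r r) ⟩
      suc (r + r)  ≤⟨ 2r+1≤Q ⟩
      Q            ∎))
    where
    open ≤-Reasoning
    lhs : ∀ m a τ b c Q → m + (1 + (suc b + c) * Q) * suc (a + τ)
          ≡ Q + (m + τ + c * Q + (suc b + c) * Q * τ)
            + (b * Q + a * (suc b + c) * Q + a + 1)
    lhs = solve-∀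
    rhs : ∀ a y b c Q → (a * (suc b + c) + b) * Q + (a + 1 + y)
          ≡ y + (b * Q + a * (suc b + c) * Q + a + 1)
    rhs = solve-∀
    Q≤y : Q ≤ y
    Q≤y = subst (Q ≤_)
      (+-cancelʳ-≡ _ _ _ (trans (sym (lhs m a τ b c Q)) (trans eq′ (rhs a y b c Q))))
      (m≤m+n Q _)

-- Put X = N P + U and P = U + W + 1. The moment inequality becomes U W ≤ N P,
-- while U ≥ N + 2 and W ≥ N + 1.
second-moment-fails : ∀ {K r a b y n} → a < suc r → b < K → a < y →
                      n ≡ (a * K + b) * geo K (2 + r) + (a + 1 + y) →
                      a + 2 + y ≤ geo K (2 + r) →
                      let N = a * K + b ; P = suc K ^ (2 + r) ; X = K * n in
                      ¬ ((2 * N + 1) * (P * X) ≤ X * X + X + N * suc N * (P * P))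
second-moment-fails {_} {r} {a} {b} {y} {n} a<r b<K a<y n≡ y< le
  with z , refl ← m≤n⇒∃[o]m+o≡n a<y | c , refl ← m≤n⇒∃[o]m+o≡n b<K | g , Q≡ ← m≤n⇒∃[o]m+o≡n y< =
  <-irrefl refl (begin-strict
    P                                    ≡⟨ P≡ ⟩
    U + W + 1                            ≡⟨ e₁ N u w ⟩
    (2 + u + w) + (2 * N + 2)            ≤⟨ +-monoˡ-≤ (2 * N + 2) small ⟩
    (2 + u) * (1 + w) + (2 * N + 2)      ≤⟨ +-monoˡ-≤ (2 * N + 2) big ⟩
    N * suc N + (2 * N + 2)              ≡⟨ e₂ N ⟩
    suc N * suc (suc N)                  ≤⟨ *-mono-≤ N< (s≤s N<) ⟩
    (suc r * K) * suc (suc r * K)        <⟨ quadratic<power (b + c) r ⟩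
    P                                    ∎)
  where
  open ≤-Reasoning
  K = suc b + c
  P = suc K ^ (2 + r)
  Q = geo K (2 + r)
  N = a * K + b
  -- Here z = y - a - 1, c = K - 1 - b, and g is the room left above y in the interval. With these,
  -- `U` is K (y + 1) - b, and `u`, `w` are the excesses over N + 2 and N + 1.
  u = 2 * c + K * z
  w = b + c + K * g
  U = N + 2 + u
  W = N + 1 + w
  X = K * n

  e₁ : ∀ N u w → N + 2 + u + (N + 1 + w) + 1 ≡ (2 + u + w) + (2 * N + 2)
  e₁ = solve-∀
  e₂ : ∀ N → N * suc N + (2 * N + 2) ≡ suc N * suc (suc N)
  e₂ = solve-∀

  P≡ : P ≡ U + W + 1
  P≡ = begin-equality
    P                                     ≡⟨ pow-geo K (2 + r) ⟩
    1 + K * Q                             ≡⟨ cong (λ x → 1 + K * x) (sym Q≡) ⟩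
    1 + K * (a + 2 + (suc a + z) + g)     ≡⟨ lem a b c z g ⟩
    U + W + 1                             ∎
    where
    lem : ∀ a b c z g → 1 + (suc b + c) * (a + 2 + (suc a + z) + g)
        ≡ (a * (suc b + c) + b + 2 + (2 * c + (suc b + c) * z))
          + (a * (suc b + c) + b + 1 + (b + c + (suc b + c) * g)) + 1
    lem = solve-∀

  X≡ : X ≡ N * P + U
  X≡ = begin-equality
    K * n                                     ≡⟨ cong (K *_) n≡ ⟩
    K * (N * Q + (a + 1 + (suc a + z)))       ≡⟨ lem a b c z Q ⟩
    N * (1 + K * Q) + U                       ≡⟨ cong (λ x → N * x + U) (sym (pow-geo K (2 + r))) ⟩
    N * P + U                                 ∎
    where
    lem : ∀ a b c z Q → (suc b + c) * ((a * (suc b + c) + b) * Q + (a + 1 + (suc a + z)))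
        ≡ (a * (suc b + c) + b) * (1 + (suc b + c) * Q)
          + (a * (suc b + c) + b + 2 + (2 * c + (suc b + c) * z))
    lem = solve-∀

  -- Without truncation, `le` reads 0 ≤ (X - N P)(X - (N + 1) P) + X, and for X = N P + U the right
  -- side equals N P - U W. The cancelled summand collects the terms common to both sides.
  UW≤NP : U * W ≤ N * P
  UW≤NP = +-cancelˡ-≤ (2 * N * N * P * P + N * P * P + 2 * N * P * U + U * U + U) _ _
    (subst₂ _≤_
      (trans (cong (λ x → (2 * N + 1) * (P * x)) X≡)
        (trans (expandˡ N P U) (trans (cong (λ x → 2 * N * N * P * P + N * P * P + 2 * N * P * U + x * U) P≡)
          (regroup (2 * N * N * P * P + N * P * P + 2 * N * P * U) U W))))
      (trans (cong (λ x → x * x + x + N * suc N * (P * P)) X≡) (expandʳ N P U)) le)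
    where
    expandˡ : ∀ N P U → (2 * N + 1) * (P * (N * P + U))
            ≡ (2 * N * N * P * P + N * P * P + 2 * N * P * U) + P * U
    expandˡ = solve-∀
    regroup : ∀ x U W → x + (U + W + 1) * U ≡ x + U * U + U + U * W
    regroup = solve-∀
    expandʳ : ∀ N P U → (N * P + U) * (N * P + U) + (N * P + U) + N * suc N * (P * P)
            ≡ 2 * N * N * P * P + N * P * P + 2 * N * P * U + U * U + U + N * P
    expandʳ = solve-∀

  big : (2 + u) * (1 + w) ≤ N * suc N
  big = +-cancelˡ-≤ (N * N + N * (3 + u + w)) _ _
    (subst₂ _≤_ (l N u w) (trans (cong (N *_) P≡) (rr N u w)) UW≤NP)
    where
    l : ∀ N u w → (N + 2 + u) * (N + 1 + w) ≡ N * N + N * (3 + u + w) + (2 + u) * (1 + w)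
    l = solve-∀
    rr : ∀ N u w → N * (N + 2 + u + (N + 1 + w) + 1) ≡ N * N + N * (3 + u + w) + N * suc N
    rr = solve-∀

  small : 2 + u + w ≤ (2 + u) * (1 + w)
  small = m+o≡n⇒m≤n (w + u * w) (lem u w)
    where
    lem : ∀ u w → 2 + u + w + (w + u * w) ≡ (2 + u) * (1 + w)
    lem = solve-∀

  N< : N < suc r * K
  N< = begin-strict
    a * K + b   <⟨ +-monoʳ-< (a * K) b<K ⟩
    a * K + K   ≡⟨ +-comm (a * K) K ⟩
    suc a * K   ≤⟨ *-monoˡ-≤ K a<r ⟩
    suc r * K   ∎

-- The difference of the two sides is the product (t - N)(t - N - 1) of consecutive integers.
integer-between : ∀ N t → (2 * N + 1) * t ≤ t * t + N * suc N
integer-between N t with ≤-total t N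
... | inj₁ t≤N with d , refl ← m≤n⇒∃[o]m+o≡n t≤N = m+o≡n⇒m≤n (d * d + d) (lem t d)
  where
  lem : ∀ t d → (2 * (t + d) + 1) * t + (d * d + d) ≡ t * t + (t + d) * suc (t + d)
  lem = solve-∀
... | inj₂ N≤t with m≤n⇒m<n∨m≡n N≤t
...   | inj₂ refl = m+o≡n⇒m≤n 0 (lem t)
  where
  lem : ∀ t → (2 * t + 1) * t + 0 ≡ t * t + t * suc t
  lem = solve-∀
...   | inj₁ N<t with d , refl ← m≤n⇒∃[o]m+o≡n N<t = m+o≡n⇒m≤n (d * d + d) (lem N d)
  where
  lem : ∀ N d → (2 * N + 1) * suc (N + d) + (d * d + d) ≡ suc (N + d) * suc (N + d) + N * suc N
  lem = solve-∀

-- Finite sums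

∑-const : ∀ n x → ∑ {n} (λ _ → x) ≡ n * x
∑-const zero    x = refl
∑-const (suc n) x = cong (x +_) (∑-const n x)

∑-mono : ∀ {n} {f g : Fin n → ℕ} → (∀ i → f i ≤ g i) → ∑ f ≤ ∑ g
∑-mono {zero}  f≤g = z≤n
∑-mono {suc n} f≤g = +-mono-≤ (f≤g zero) (∑-mono (f≤g ∘ suc))

funToFin-cong : ∀ {m n} {f g : Fin m → Fin n} → (∀ i → f i ≡ g i) → funToFin f ≡ funToFin g
funToFin-cong {zero}  f≗g = refl
funToFin-cong {suc m} f≗g = cong₂ combine (f≗g zero) (funToFin-cong (f≗g ∘ suc))

∣-∑ : ∀ {d n} (f : Fin n → ℕ) → (∀ i → d ∣ f i) → d ∣ ∑ f
∣-∑ {n = zero}  f d∣f = _ ∣0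
∣-∑ {n = suc n} f d∣f = ∣m∣n⇒∣m+n (d∣f zero) (∣-∑ (f ∘ suc) (d∣f ∘ suc))

∑-single : ∀ {n} (f : Fin n → ℕ) i → (∀ {j} → j ≢ i → f j ≡ 0) → ∑ f ≡ f i
∑-single {suc n} f i f≡0 = trans (∑-remove {i = i} f)
  (trans (cong (f i +_) (trans (∑-cong {n} (λ j → f≡0 (Fin.punchInᵢ≢i i j))) (trans (∑-const n 0) (*-zeroʳ n))))
    (+-identityʳ (f i)))

[_≟_] : ∀ {n} → Fin n → Fin n → ℕ
[ i ≟ j ] with i Fin.≟ j
... | yes _ = 1
... | no  _ = 0

[≟]-refl : ∀ {n} (i : Fin n) → [ i ≟ i ] ≡ 1
[≟]-refl i with i Fin.≟ i
... | yes _  = refl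
... | no i≢i = contradiction refl i≢i

[≟]-≢ : ∀ {n} {i j : Fin n} → i ≢ j → [ i ≟ j ] ≡ 0
[≟]-≢ {i = i} {j} i≢j with i Fin.≟ j
... | yes i≡j = contradiction i≡j i≢j
... | no  _   = refl

-- Turns a cardinality given by a listing into a sum: χ is the sum over i of the indicators of the
-- single values `f i`, and exchanging the two sums leaves m ones.
∑-image : ∀ {m n} (f : Fin m → Fin n) (χ : Fin n → ℕ) → (∀ {i j} → f i ≡ f j → i ≡ j) →
          (∀ i → χ (f i) ≡ 1) → (∀ k → (∀ i → f i ≢ k) → χ k ≡ 0) → ∑ χ ≡ m
∑-image {m} {n} f χ f-inj on off = begin
  ∑ χ                                    ≡⟨ ∑-cong {n} fibre ⟩
  ∑ (λ k → ∑ (λ i → [ f i ≟ k ]))        ≡⟨ ∑-comm (λ k i → [ f i ≟ k ]) ⟩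
  ∑ (λ i → ∑ (λ k → [ f i ≟ k ]))        ≡⟨ ∑-cong {m} (λ i → trans
                                              (∑-single (λ k → [ f i ≟ k ]) (f i) (λ k≢ → [≟]-≢ (k≢ ∘ sym)))
                                              ([≟]-refl (f i))) ⟩
  ∑ {m} (λ _ → 1)                        ≡⟨ trans (∑-const m 1) (*-identityʳ m) ⟩
  m                                      ∎
  where
  open ≡-Reasoning
  fibre : ∀ k → χ k ≡ ∑ (λ i → [ f i ≟ k ])
  fibre k with Fin.any? (λ i → f i Fin.≟ k)
  ... | yes (i , refl) = trans (on i) (sym (trans
    (∑-single (λ j → [ f j ≟ f i ]) i (λ j≢i → [≟]-≢ (j≢i ∘ f-inj))) ([≟]-refl (f i))))
  ... | no none = trans (off k (λ i eq → none (i , eq))) (sym (trans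
    (∑-cong {m} (λ i → [≟]-≢ (λ eq → none (i , eq)))) (trans (∑-const m 0) (*-zeroʳ m))))

∑-% : ∀ {n} D .{{_ : NonZero D}} (f : Fin n → ℕ) a → (∀ i → f i % D ≡ a % D) → ∑ f % D ≡ (n * a) % D
∑-% {zero}  D f a f≡a = refl
∑-% {suc n} D f a f≡a = begin
  (f zero + ∑ (f ∘ suc)) % D                 ≡⟨ %-distribˡ-+ (f zero) _ D ⟩
  (f zero % D + ∑ (f ∘ suc) % D) % D         ≡⟨ cong₂ (λ x y → (x + y) % D) (f≡a zero) (∑-% D (f ∘ suc) a (f≡a ∘ suc)) ⟩
  (a % D + (n * a) % D) % D                  ≡⟨ %-distribˡ-+ a (n * a) D ⟨
  (a + n * a) % D                            ∎
  where open ≡-Reasoning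

-- Comparing two hyperplanes eliminates the unspecified integer residue u and returns to remainders
-- of natural numbers.
∣-difference⇒%-≡ : ∀ {D m m′ u} .{{_ : NonZero D}} →
                   ⁺ D ∣ℤ (⁺ m -ℤ u) → ⁺ D ∣ℤ (⁺ m′ -ℤ u) → m % D ≡ m′ % D
∣-difference⇒%-≡ {D} {m} {m′} {u} d d′ =
  [ (λ m≤m′ → sym (ordered m≤m′ d d′)) , (λ m′≤m → ordered m′≤m d′ d) ]′ (≤-total m m′)
  where
  cancel : ∀ m m′ u → (m -ℤ u) -ℤ (m′ -ℤ u) ≡ m -ℤ m′
  cancel = ℤSolver.solve-∀
  ordered : ∀ {m m′} → m ≤ m′ → ⁺ D ∣ℤ (⁺ m -ℤ u) → ⁺ D ∣ℤ (⁺ m′ -ℤ u) → m′ % D ≡ m % D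
  ordered {m} {m′} m≤m′ d d′ = trans (cong (_% D) (sym (m+[n∸m]≡n m≤m′))) (%-remove-+ʳ m D∣m′∸m)
    where
    D∣m′∸m : D ∣ m′ ∸ m
    D∣m′∸m = subst (D ∣_) (ℤ.∣⊖∣-≤ m≤m′) (subst (⁺ D ∣ℤ_)
      (trans (cancel (⁺ m) (⁺ m′) u) (ℤ.[+m]-[+n]≡m⊖n m m′))
      (Signed.∣⇒∣ᵤ {⁺ D} {(⁺ m -ℤ u) -ℤ (⁺ m′ -ℤ u)}
        (Signed.∣m∣n⇒∣m-n (Signed.∣ᵤ⇒∣ {⁺ D} {⁺ m -ℤ u} d) (Signed.∣ᵤ⇒∣ {⁺ D} {⁺ m′ -ℤ u} d′))))

all⊎any : ∀ {n a b} {A : Fin n → Set a} {B : Fin n → Set b} → (∀ i → A i ⊎ B i) → (∀ i → A i) ⊎ ∃ B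
all⊎any {zero}  f = inj₁ λ ()
all⊎any {suc n} f with f zero | all⊎any (f ∘ suc)
... | inj₂ b | _            = inj₂ (zero , b)
... | inj₁ a | inj₂ (i , b) = inj₂ (suc i , b)
... | inj₁ a | inj₁ as      = inj₁ λ { zero → a ; (suc i) → as i }

q^m∣q^n : ∀ q {m n} → m ≤ n → q ^ m ∣ q ^ n
q^m∣q^n q {m} m≤n with o , refl ← m≤n⇒∃[o]m+o≡n m≤n =
  divides (q ^ o) (trans (^-distribˡ-+-* q m o) (*-comm (q ^ m) (q ^ o)))

-- Write n = N Q + j with j < Q. Since q^(r + 1) = 1 + K Q, each of the j units can be traded
-- together with K copies of Q for one power, which is possible once j K ≤ N. For N = a K + b with a
-- < r this means j ≤ a, and j > a is precisely the interval of a and b. For N ≥ r K the bound on n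
-- gives j ≤ r.
¬gap⇒combination : ∀ {k r n} → let K = suc k in n ≤ r * suc K ^ suc r → ¬ Gap K r n →
                   ∃ λ A → ∃ λ B → n ≡ A * geo K (suc r) + B * suc K ^ suc r
¬gap⇒combination {k} {r} {n} n≤ ¬gap = go (N <? r * K)
  where
  K = suc k
  Q = geo K (suc r)
  2r+1≤Q : suc (r + r) ≤ Q
  2r+1≤Q = 2j+1≤geo k r
  Q≢0 : NonZero Q
  Q≢0 = >-nonZero (≤-trans (s≤s z≤n) 2r+1≤Q)
  N = _/_ n Q {{Q≢0}}
  j = _%_ n Q {{Q≢0}}
  n≡ : n ≡ j + N * Q
  n≡ = m≡m%n+[m/n]*n n Q {{Q≢0}}
  j<Q : j < Q
  j<Q = m%n<n n Q {{Q≢0}}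

  exchange : ∀ {e c} → N ≡ (j + e) * K + c → n ≡ (e * K + c) * Q + j * suc K ^ suc r
  exchange {e} {c} N≡ = begin
    n                                      ≡⟨ n≡ ⟩
    j + N * Q                              ≡⟨ cong (λ N → j + N * Q) N≡ ⟩
    j + ((j + e) * K + c) * Q              ≡⟨ lem j e K c Q ⟩
    (e * K + c) * Q + j * (1 + K * Q)      ≡⟨ cong (λ P → (e * K + c) * Q + j * P) (pow-geo K (suc r)) ⟨
    (e * K + c) * Q + j * suc K ^ suc r    ∎
    where
    open ≡-Reasoning
    lem : ∀ j e K c Q → j + ((j + e) * K + c) * Q ≡ (e * K + c) * Q + j * (1 + K * Q)
    lem = solve-∀

  j≤r : r * K ≤ N → j ≤ r
  j≤r rK≤N = ≤-trans (m≤m+n j ((N ∸ r * K) * Q)) (+-cancelʳ-≤ (r * K * Q) _ _ (begin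
    j + (N ∸ r * K) * Q + r * K * Q      ≡⟨ lem j (r * K) (N ∸ r * K) Q ⟨
    j + (r * K + (N ∸ r * K)) * Q        ≡⟨ cong (λ N → j + N * Q) (m+[n∸m]≡n rK≤N) ⟩
    j + N * Q                            ≡⟨ n≡ ⟨
    n                                    ≤⟨ n≤ ⟩
    r * suc K ^ suc r                    ≡⟨ cong (r *_) (pow-geo K (suc r)) ⟩
    r * (1 + K * Q)                      ≡⟨ lem′ r K Q ⟩
    r + r * K * Q                        ∎))
    where
    open ≤-Reasoning
    lem : ∀ j R d Q → j + (R + d) * Q ≡ j + d * Q + R * Q
    lem = solve-∀
    lem′ : ∀ r K Q → r * (1 + K * Q) ≡ r + r * K * Q
    lem′ = solve-∀

  a = N / K
  b = N % K
  N≡ : N ≡ a * K + b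
  N≡ = trans (m≡m%n+[m/n]*n N K) (+-comm b (a * K))

  go : Dec (N < r * K) → _
  go (no N≮rK) with e , j+e≡r ← m≤n⇒∃[o]m+o≡n (j≤r (≮⇒≥ N≮rK)) =
    e * K + (N ∸ r * K) , j ,
    exchange {e} (trans (sym (m+[n∸m]≡n (≮⇒≥ N≮rK))) (cong (λ r′ → r′ * K + (N ∸ r * K)) (sym j+e≡r)))
  go (yes N<rK) with j ≤? a
  ... | yes j≤a with e , j+e≡a ← m≤n⇒∃[o]m+o≡n j≤a =
    e * K + b , j , exchange {e} (trans N≡ (cong (λ a → a * K + b) (sym j+e≡a)))
  ... | no  j≰a with y , a+y≡j ← m≤n⇒∃[o]m+o≡n (≰⇒> j≰a) = contradiction
    (gap a b y (m<n*o⇒m/o<n N<rK) (m%n<n N K)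
      (trans n≡ (trans (cong₂ (λ j N → j + N * Q) (sym a+y≡j) N≡) (lem a (a * K + b) y Q)))
      (subst (_≤ Q) (trans (cong suc (sym a+y≡j)) (lem′ a y)) j<Q)) ¬gap
    where
    lem : ∀ a N y Q → suc a + y + N * Q ≡ N * Q + (a + 1 + y)
    lem = solve-∀
    lem′ : ∀ a y → suc (suc a + y) ≡ a + 2 + y
    lem′ = solve-∀

-- Concatenated families and listings of decidable subsets

module _ {a ℓ} (M : Monoid a ℓ) where
  open Monoid M
  open MonoidSum M using (sum)

  sum-split : ∀ m {n} (f : Fin (m + n) → Carrier) → sum f ≈ sum (λ i → f (i ↑ˡ n)) ∙ sum (λ i → f (m ↑ʳ i))
  sum-split zero    f = Monoid.sym M (identityˡ _)
  sum-split (suc m) f = Monoid.trans M (∙-congˡ (sum-split m (f ∘ suc))) (Monoid.sym M (assoc _ _ _))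

module _ {a p : Level} {A : Set a} {m n : ℕ} (xs : Fin m → A) (ys : Fin n → A) where

  ++-all : ∀ {P : A → Set p} → (∀ i → P (xs i)) → (∀ i → P (ys i)) → ∀ i → P ((xs ++ ys) i)
  ++-all pxs pys i with splitAt m i
  ... | inj₁ i′ = pxs i′
  ... | inj₂ i′ = pys i′

  ++-pairwise : ∀ {R : A → A → Set p} → (∀ {i j} → i ≢ j → R (xs i) (xs j)) → (∀ {i j} → i ≢ j → R (ys i) (ys j)) →
                (∀ i j → R (xs i) (ys j)) → (∀ i j → R (ys i) (xs j)) →
                ∀ {i j} → i ≢ j → R ((xs ++ ys) i) ((xs ++ ys) j)
  ++-pairwise rx ry rxy ryx {i} {j} i≢j with splitAt m i in eqᵢ | splitAt m j in eqⱼ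
  ... | inj₁ i′ | inj₁ j′ = rx λ { refl → i≢j (trans (sym (Fin.splitAt⁻¹-↑ˡ eqᵢ)) (Fin.splitAt⁻¹-↑ˡ eqⱼ)) }
  ... | inj₁ i′ | inj₂ j′ = rxy i′ j′
  ... | inj₂ i′ | inj₁ j′ = ryx i′ j′
  ... | inj₂ i′ | inj₂ j′ = ry λ { refl → i≢j (trans (sym (Fin.splitAt⁻¹-↑ʳ eqᵢ)) (Fin.splitAt⁻¹-↑ʳ eqⱼ)) }

∑-++ : ∀ {a} {A : Set a} {m n} (f : A → ℕ) (xs : Fin m → A) (ys : Fin n → A) →
       ∑ (λ i → f ((xs ++ ys) i)) ≡ ∑ (λ i → f (xs i)) + ∑ (λ i → f (ys i))
∑-++ {m = m} {n} f xs ys = trans (sum-split +-0-monoid m (λ i → f ((xs ++ ys) i)))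
  (cong₂ _+_ (∑-cong {m} (λ i → cong f (VecF.lookup-++ˡ xs ys i))) (∑-cong {n} (λ i → cong f (VecF.lookup-++ʳ xs ys i))))

record Enumeration {n p} (P : Fin n → Set p) : Set p where
  field
    size       : ℕ
    elems      : Fin size → Fin n
    sound      : ∀ i → P (elems i)
    injective  : ∀ {i j} → elems i ≡ elems j → i ≡ j
    complete   : ∀ {k} → P k → ∃ λ i → elems i ≡ k

enumerate : ∀ {n p} {P : Fin n → Set p} → (∀ i → Dec (P i)) → Enumeration P
enumerate {zero}  P? = record
  { size = 0 ; elems = λ () ; sound = λ () ; injective = λ { {()} } ; complete = λ { {()} } }
enumerate {suc n} P? with P? zero | enumerate (P? ∘ suc)
... | no ¬p | E = record
  { size = E.size ; elems = suc ∘ E.elems ; sound = E.sound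
  ; injective = E.injective ∘ Fin.suc-injective
  ; complete = λ { {zero} p → contradiction p ¬p
                 ; {suc k} p → proj₁ (E.complete p) , cong suc (proj₂ (E.complete p)) } }
  where module E = Enumeration E
... | yes p | E = record
  { size = suc E.size
  ; elems = λ { zero → zero ; (suc i) → suc (E.elems i) }
  ; sound = λ { zero → p ; (suc i) → E.sound i }
  ; injective = λ { {zero} {zero} _ → refl
                  ; {suc i} {suc j} eq → cong suc (E.injective (Fin.suc-injective eq)) }
  ; complete = λ { {zero} _ → zero , refl
                 ; {suc k} p → suc (proj₁ (E.complete p)) , cong suc (proj₂ (E.complete p)) } }
  where module E = Enumeration E

-- Translation between the stated intervals and `Gap`

geo-quotient : ∀ k r → [ r ,1] (2 + k) ≡ geo (suc k) r
geo-quotient k r = trans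
  (cong (λ p → (p ∸ 1) / suc k) (pow-geo (suc k) r))
  (trans (cong (_/ suc k) (*-comm (suc k) (geo (suc k) r))) (m*n/n≡m (geo (suc k) r) (suc k)))

interval⇒gap : ∀ {k r n a b} → b ≤ k → a < r →
               n ∈[ (a * suc k + b) * geo (suc k) (suc r) + a + 1 , (a * suc k + b + 1) * geo (suc k) (suc r) ∸ 1 ] →
               Gap (suc k) r n
interval⇒gap {k} {r} {n} {a} {b} b≤k a<r (lo , hi) with y , eq ← m≤n⇒∃[o]m+o≡n lo =
  gap a b y a<r (s≤s b≤k) n≡ (+-cancelˡ-≤ (N * Q) _ _ (begin
    N * Q + (a + 2 + y)          ≡⟨ e₂ (N * Q) a y ⟩
    N * Q + (a + 1 + y) + 1      ≡⟨ cong (_+ 1) n≡ ⟨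
    n + 1                        ≤⟨ +-monoˡ-≤ 1 hi ⟩
    (N + 1) * Q ∸ 1 + 1          ≡⟨ m∸n+n≡m 1≤[N+1]Q ⟩
    (N + 1) * Q                  ≡⟨ e₃ N Q ⟩
    N * Q + Q                    ∎))
  where
  open ≤-Reasoning
  N = a * suc k + b
  Q = geo (suc k) (suc r)
  e₁ : ∀ m a y → m + a + 1 + y ≡ m + (a + 1 + y)
  e₁ = solve-∀
  e₂ : ∀ m a y → m + (a + 2 + y) ≡ m + (a + 1 + y) + 1
  e₂ = solve-∀
  e₃ : ∀ N Q → (N + 1) * Q ≡ N * Q + Q
  e₃ = solve-∀
  n≡ : n ≡ N * Q + (a + 1 + y)
  n≡ = trans (sym eq) (e₁ (N * Q) a y)
  1≤[N+1]Q : 1 ≤ (N + 1) * Q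
  1≤[N+1]Q = subst (1 ≤_) (sym (e₃ N Q)) (≤-trans (≤-trans (s≤s z≤n) (2j+1≤geo k r)) (m≤n+m Q (N * Q)))

gap⇒interval : ∀ {k r n} (g : Gap (suc k) r n) → let open Gap g in
               n ∈[ (a * suc k + b) * geo (suc k) (suc r) + a + 1 , (a * suc k + b + 1) * geo (suc k) (suc r) ∸ 1 ]
gap⇒interval {k} {r} {n} (gap a b y _ _ n≡ y<) =
  m+o≡n⇒m≤n y (trans (e₁ (N * Q) a y) (sym n≡)) ,
  ∸-monoˡ-≤ {suc n} {(N + 1) * Q} 1 (begin
    suc n                          ≡⟨ cong suc n≡ ⟩
    suc (N * Q + (a + 1 + y))      ≡⟨ e₂ (N * Q) a y ⟩
    N * Q + (a + 2 + y)            ≤⟨ +-monoʳ-≤ (N * Q) y< ⟩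
    N * Q + Q                      ≡⟨ e₃ N Q ⟩
    (N + 1) * Q                    ∎)
  where
  open ≤-Reasoning
  N = a * suc k + b
  Q = geo (suc k) (suc r)
  e₁ : ∀ m a y → m + a + 1 + y ≡ m + (a + 1 + y)
  e₁ = solve-∀
  e₂ : ∀ m a y → suc (m + (a + 1 + y)) ≡ m + (a + 2 + y)
  e₂ = solve-∀
  e₃ : ∀ N Q → N * Q + Q ≡ (N + 1) * Q
  e₃ = solve-∀

-- Finite fields

module FiniteFields {c ℓ ℓ#} {K : ℕ} (F : FiniteField c ℓ ℓ# (suc K)) where

  open FiniteField F
    using (Carrier; _≈_; 0#; 1#; setoid; ring; heytingField; order)
    renaming (_+_ to _+ᶠ_; _*_ to _*ᶠ_; -_ to -ᶠ_; refl to ≈-refl; sym to ≈-sym; trans to ≈-trans)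
  private module F = FiniteField F
  open SemiringSum F.semiring using () renaming (sum to sumᶠ)
  private module Sumᶠ = SemiringSum F.semiring

  q : ℕ
  q = suc K

  private module O = Inverse order

  elem : Fin q → Carrier
  elem = O.from

  elem-to : ∀ x → elem (O.to x) ≈ x
  elem-to = O.strictlyInverseʳ

  to-elem : ∀ i → O.to (elem i) ≡ i
  to-elem = O.strictlyInverseˡ

  to-injective : ∀ {x y} → O.to x ≡ O.to y → x ≈ y
  to-injective {x} {y} eq =
    ≈-trans (≈-sym (elem-to x)) (≈-trans (F.reflexive (cong elem eq)) (elem-to y))

  infix 4 _≈?_

  _≈?_ : ∀ x y → Dec (x ≈ y)
  x ≈? y = map′ to-injective O.to-cong (O.to x Fin.≟ O.to y)

  -- Non-triviality comes from the apartness: 1 - 0 is invertible, so 1 is apart from 0, and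
  -- apartness is irreflexive.
  1≉0 : ¬ (1# ≈ 0#)
  1≉0 1≈0 = #-irrefl 1≈0 (invertible⇒# (1# , 1*x≈1 , ≈-trans (F.*-comm _ _) 1*x≈1))
    where
    open HeytingField heytingField using (#-irrefl; invertible⇒#)
    open RingProps ring using (-0#≈0#)
    1*x≈1 : 1# *ᶠ (1# +ᶠ -ᶠ 0#) ≈ 1#
    1*x≈1 = ≈-trans (F.*-identityˡ _) (≈-trans (F.+-congˡ -0#≈0#) (F.+-identityʳ 1#))

  -- Apartness is not known to be decidable, so the inverse is found by search:
  -- if there were none, x would not be apart from 0, hence equal to it.
  inverse : ∀ x → ¬ (x ≈ 0#) → ∃ λ y → y *ᶠ x ≈ 1#
  inverse x x≉0 with Fin.any? (λ i → elem i *ᶠ x ≈? 1#)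
  ... | yes (i , eq) = elem i , eq
  ... | no none      = contradiction (proj₁ (tight x 0#) ¬x#0) x≉0
    where
    open HeytingField heytingField using (tight; #⇒invertible; _#_)
    open RingProps ring using (-0#≈0#)
    ¬x#0 : ¬ (x # 0#)
    ¬x#0 x#0 with y , yx≈1 , _ ← #⇒invertible x#0 = none (O.to y ,
      ≈-trans (F.*-cong (elem-to y)
        (≈-sym (≈-trans (F.+-congˡ -0#≈0#) (F.+-identityʳ x)))) yx≈1)

  nz : Carrier → ℕ
  nz x with x ≈? 0#
  ... | yes _ = 0
  ... | no  _ = 1

  nz-zero : ∀ {x} → x ≈ 0# → nz x ≡ 0
  nz-zero {x} x≈0 with x ≈? 0#
  ... | yes _  = refl
  ... | no x≉0 = contradiction x≈0 x≉0

  nz-nonzero : ∀ {x} → ¬ (x ≈ 0#) → nz x ≡ 1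
  nz-nonzero {x} x≉0 with x ≈? 0#
  ... | yes x≈0 = contradiction x≈0 x≉0
  ... | no _    = refl

  nz-cong : ∀ {x y} → x ≈ y → nz x ≡ nz y
  nz-cong {x} {y} x≈y with y ≈? 0#
  ... | yes y≈0 = nz-zero (≈-trans x≈y y≈0)
  ... | no  y≉0 = nz-nonzero (λ x≈0 → y≉0 (≈-trans (≈-sym x≈y) x≈0))

  nz-idem : ∀ x → nz x * nz x ≡ nz x
  nz-idem x with x ≈? 0#
  ... | yes _ = refl
  ... | no  _ = refl

  nz≤1 : ∀ x → nz x ≤ 1
  nz≤1 x with x ≈? 0#
  ... | yes _ = z≤n
  ... | no  _ = ≤-refl

  x-y≈0⇒x≈y : ∀ {x y} → x +ᶠ -ᶠ y ≈ 0# → x ≈ y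
  x-y≈0⇒x≈y = RingProps.x∙y⁻¹≈ε⇒x≈y ring _ _

  *-cancelˡ-zero : ∀ {x y} → ¬ (x ≈ 0#) → x *ᶠ y ≈ 0# → y ≈ 0#
  *-cancelˡ-zero {x} {y} x≉0 xy≈0 with z , zx≈1 ← inverse x x≉0 = begin
    y                ≈⟨ F.*-identityˡ y ⟨
    1# *ᶠ y          ≈⟨ F.*-congʳ zx≈1 ⟨
    (z *ᶠ x) *ᶠ y    ≈⟨ F.*-assoc z x y ⟩
    z *ᶠ (x *ᶠ y)    ≈⟨ F.*-congˡ xy≈0 ⟩
    z *ᶠ 0#          ≈⟨ F.zeroʳ z ⟩
    0#               ∎
    where open SetoidReasoning setoid

  *-cancelˡ-≈ : ∀ {x y z} → ¬ (x ≈ 0#) → x *ᶠ y ≈ x *ᶠ z → y ≈ z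
  *-cancelˡ-≈ {x} {y} {z} x≉0 eq = x-y≈0⇒x≈y (*-cancelˡ-zero x≉0 (begin
    x *ᶠ (y +ᶠ -ᶠ z)            ≈⟨ F.distribˡ x y (-ᶠ z) ⟩
    x *ᶠ y +ᶠ x *ᶠ (-ᶠ z)       ≈⟨ F.+-cong eq (≈-sym (RingProps.-‿distribʳ-* ring x z)) ⟩
    x *ᶠ z +ᶠ -ᶠ (x *ᶠ z)       ≈⟨ F.-‿inverseʳ _ ⟩
    0#                          ∎))
    where open SetoidReasoning setoid

  ∑-nz-const : ∀ d c → d ≈ 0# → ∑ (λ i → nz (c +ᶠ elem i *ᶠ d)) ≡ q * nz c
  ∑-nz-const d c d≈0 = trans
    (∑-cong {q} (λ i → nz-cong (≈-trans (F.+-congˡ (≈-trans (F.*-congˡ d≈0) (F.zeroʳ (elem i)))) (F.+-identityʳ c))))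
    (∑-const q (nz c))

  -- The only root of an affine function of nonzero slope is - c / d; the other K = q - 1 field
  -- elements each contribute 1.
  ∑-nz-affine : ∀ d c → ¬ (d ≈ 0#) → ∑ (λ i → nz (c +ᶠ elem i *ᶠ d)) ≡ K
  ∑-nz-affine d c d≉0 with d⁻¹ , d⁻¹d≈1 ← inverse d d≉0 = begin
    ∑ f                         ≡⟨ ∑-remove {i = i₀} f ⟩
    f i₀ + ∑ (removeAt f i₀)    ≡⟨ cong₂ _+_ (nz-zero (root i₀ (elem-to _))) (∑-cong rest) ⟩
    ∑ {K} (λ _ → 1)             ≡⟨ ∑-const K 1 ⟩
    K * 1                       ≡⟨ *-identityʳ K ⟩
    K                           ∎
    where
    open ≡-Reasoning
    open RingProps ring using (-‿distribˡ-*)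
    f : Fin q → ℕ
    f i = nz (c +ᶠ elem i *ᶠ d)
    z = -ᶠ (c *ᶠ d⁻¹)
    i₀ = O.to z
    zd : z *ᶠ d ≈ -ᶠ c
    zd = begin′
      z *ᶠ d                ≈⟨ -‿distribˡ-* _ _ ⟨
      -ᶠ (c *ᶠ d⁻¹ *ᶠ d)    ≈⟨ F.-‿cong (F.*-assoc c d⁻¹ d) ⟩
      -ᶠ (c *ᶠ (d⁻¹ *ᶠ d))  ≈⟨ F.-‿cong (F.*-congˡ d⁻¹d≈1) ⟩
      -ᶠ (c *ᶠ 1#)          ≈⟨ F.-‿cong (F.*-identityʳ c) ⟩
      -ᶠ c                  ∎′
      where open SetoidReasoning setoid renaming (begin_ to begin′_; _∎ to _∎′)
    root : ∀ i → elem i ≈ z → c +ᶠ elem i *ᶠ d ≈ 0#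
    root i eq = ≈-trans (F.+-congˡ (≈-trans (F.*-congʳ eq) zd)) (F.-‿inverseʳ c)
    rest : ∀ j → f (punchIn i₀ j) ≡ 1
    rest j = nz-nonzero λ eq → Fin.punchInᵢ≢i i₀ j (trans (sym (to-elem _)) (O.to-cong (only eq)))
      where
      only : c +ᶠ elem (punchIn i₀ j) *ᶠ d ≈ 0# → elem (punchIn i₀ j) ≈ z
      only eq = *-cancelˡ-≈ d≉0 (≈-trans (F.*-comm d _)
        (≈-trans (≈-trans (RingProps.+-inverseʳ-unique ring _ _ eq) (≈-sym zd)) (F.*-comm z d)))

  -- Dot products and sums over all vectors

  module _ {v : ℕ} where

    open PG F v using (V; 0ᵥ; _+ᵥ_; _·ᵥ_; linComb)

    infix 4 _≋_

    _≋_ : V → V → Set ℓ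
    x ≋ y = ∀ i → x i ≈ y i

    dot : V → V → Carrier
    dot h x = sumᶠ (λ i → h i *ᶠ x i)

    dot-cong : ∀ {h h′ x x′} → h ≋ h′ → x ≋ x′ → dot h x ≈ dot h′ x′
    dot-cong h≋ x≋ = Sumᶠ.sum-cong-≋ (λ i → F.*-cong (h≋ i) (x≋ i))

    dot-comm : ∀ h x → dot h x ≈ dot x h
    dot-comm h x = Sumᶠ.sum-cong-≋ (λ i → F.*-comm (h i) (x i))

    dot-+ˡ : ∀ h g x → dot (h +ᵥ g) x ≈ dot h x +ᶠ dot g x
    dot-+ˡ h g x = ≈-trans (Sumᶠ.sum-cong-≋ (λ i → F.distribʳ (x i) (h i) (g i)))
      (Sumᶠ.∑-distrib-+ (λ i → h i *ᶠ x i) (λ i → g i *ᶠ x i))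

    dot-·ˡ : ∀ a h x → dot (a ·ᵥ h) x ≈ a *ᶠ dot h x
    dot-·ˡ a h x = ≈-trans (Sumᶠ.sum-cong-≋ (λ i → F.*-assoc a (h i) (x i)))
      (≈-sym (Sumᶠ.*-distribˡ-sum a (λ i → h i *ᶠ x i)))

    dot-+·ˡ : ∀ h a g x → dot (h +ᵥ a ·ᵥ g) x ≈ dot h x +ᶠ a *ᶠ dot g x
    dot-+·ˡ h a g x = ≈-trans (dot-+ˡ h (a ·ᵥ g) x) (F.+-congˡ (dot-·ˡ a g x))

    dot-+ʳ : ∀ h x y → dot h (x +ᵥ y) ≈ dot h x +ᶠ dot h y
    dot-+ʳ h x y = ≈-trans (dot-comm h _) (≈-trans (dot-+ˡ x y h) (F.+-cong (dot-comm x h) (dot-comm y h)))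

    dot-·ʳ : ∀ a h x → dot h (a ·ᵥ x) ≈ a *ᶠ dot h x
    dot-·ʳ a h x = ≈-trans (dot-comm h _) (≈-trans (dot-·ˡ a x h) (F.*-congˡ (dot-comm x h)))

    dot-0ˡ : ∀ {h} x → h ≋ 0ᵥ → dot h x ≈ 0#
    dot-0ˡ x h≋0 = ≈-trans (Sumᶠ.sum-cong-≋ (λ i → ≈-trans (F.*-congʳ (h≋0 i)) (F.zeroˡ (x i))))
      (Sumᶠ.sum-replicate-zero v)

    dot-0ʳ : ∀ h {x} → x ≋ 0ᵥ → dot h x ≈ 0#
    dot-0ʳ h x≋0 = ≈-trans (dot-comm h _) (dot-0ˡ h x≋0)

    dot-linComb : ∀ {k} h a (b : Vector V k) → dot h (linComb a b) ≈ sumᶠ (λ i → a i *ᶠ dot h (b i))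
    dot-linComb {k} h a b = begin
      sumᶠ (λ j → h j *ᶠ sumᶠ (λ i → a i *ᶠ b i j))
        ≈⟨ Sumᶠ.sum-cong-≋ (λ j → Sumᶠ.*-distribˡ-sum (h j) (λ i → a i *ᶠ b i j)) ⟩
      sumᶠ (λ j → sumᶠ (λ i → h j *ᶠ (a i *ᶠ b i j)))
        ≈⟨ Sumᶠ.∑-comm (λ j i → h j *ᶠ (a i *ᶠ b i j)) ⟩
      sumᶠ (λ i → sumᶠ (λ j → h j *ᶠ (a i *ᶠ b i j)))
        ≈⟨ Sumᶠ.sum-cong-≋ {k} (λ i → Sumᶠ.sum-cong-≋ (λ j → x∙yz≈y∙xz (h j) (a i) (b i j))) ⟩
      sumᶠ (λ i → sumᶠ (λ j → a i *ᶠ (h j *ᶠ b i j)))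
        ≈⟨ Sumᶠ.sum-cong-≋ {k} (λ i → ≈-sym (Sumᶠ.*-distribˡ-sum (a i) (λ j → h j *ᶠ b i j))) ⟩
      sumᶠ (λ i → a i *ᶠ dot h (b i)) ∎
      where
      open SetoidReasoning setoid
      open CSG F.*-commutativeSemigroup using (x∙yz≈y∙xz)

    enum : Fin (q ^ v) → V
    enum k i = elem (finToFun k i)

    index : V → Fin (q ^ v)
    index x = funToFin (O.to ∘ x)

    enum-index : ∀ x → enum (index x) ≋ x
    enum-index x i = ≈-trans (F.reflexive (cong elem (Fin.finToFun-funToFin (O.to ∘ x) i))) (elem-to (x i))

    index-cong : ∀ {x y} → x ≋ y → index x ≡ index y
    index-cong x≋y = funToFin-cong (λ i → O.to-cong (x≋y i))

    index-injective : ∀ {x y} → index x ≡ index y → x ≋ y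
    index-injective {x} {y} eq i =
      ≈-trans (≈-sym (enum-index x i)) (≈-trans (F.reflexive (cong (λ k → enum k i) eq)) (enum-index y i))

    index-enum : ∀ k → index (enum k) ≡ k
    index-enum k = trans (funToFin-cong {v} (λ i → to-elem (finToFun k i))) (Fin.funToFin-finToFin {v} {q} k)

    ∑ᵥ : (V → ℕ) → ℕ
    ∑ᵥ f = ∑ (f ∘ enum)

    Congruent : (V → ℕ) → Set _
    Congruent f = ∀ {x y} → x ≋ y → f x ≡ f y

    ∑ᵥ-translate : ∀ {f} → Congruent f → ∀ t → ∑ᵥ f ≡ ∑ᵥ (λ h → f (h +ᵥ t))
    ∑ᵥ-translate {f} f-cong t =
      trans (∑-permutation (f ∘ enum) π) (∑-cong (λ k → f-cong (enum-index (enum k +ᵥ t))))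
      where
      shift : V → Fin (q ^ v) → Fin (q ^ v)
      shift t k = index (enum k +ᵥ t)
      shift-shift : ∀ t u → (∀ i → t i +ᶠ u i ≈ 0#) → ∀ k → shift u (shift t k) ≡ k
      shift-shift t u t+u≈0 k = trans (index-cong (λ i →
        ≈-trans (F.+-congʳ (enum-index (enum k +ᵥ t) i)) (≈-trans (F.+-assoc _ _ _)
          (≈-trans (F.+-congˡ (t+u≈0 i)) (F.+-identityʳ _))))) (index-enum k)
      -t : V
      -t i = -ᶠ t i
      π : Permutation (q ^ v) (q ^ v)
      π = permutation (shift t) (shift -t)
        (shift-shift -t t (λ i → F.-‿inverseˡ (t i)))
        (shift-shift t -t (λ i → F.-‿inverseʳ (t i)))

    -- Averaging over the translates by multiples of `e` sums along lines without choosing coset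
    -- representatives. The price is the factor q that the counts and moments below carry.
    ∑ᵥ-average : ∀ {f} → Congruent f → ∀ e → q * ∑ᵥ f ≡ ∑ᵥ (λ h → ∑ (λ i → f (h +ᵥ elem i ·ᵥ e)))
    ∑ᵥ-average {f} f-cong e = begin
      q * ∑ᵥ f                                       ≡⟨ ∑-const q (∑ᵥ f) ⟨
      ∑ {q} (λ _ → ∑ᵥ f)                             ≡⟨ ∑-cong (λ i → ∑ᵥ-translate f-cong (elem i ·ᵥ e)) ⟩
      ∑ (λ i → ∑ᵥ (λ h → f (h +ᵥ elem i ·ᵥ e)))      ≡⟨ ∑-comm (λ i k → f (enum k +ᵥ elem i ·ᵥ e)) ⟩
      ∑ᵥ (λ h → ∑ (λ i → f (h +ᵥ elem i ·ᵥ e)))      ∎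
      where open ≡-Reasoning

    -- Along each line in direction `e` the argument of `nz` is affine with slope `dot e x`. The
    -- constant `c` is 0 for the moments; the weights of an affine space need an arbitrary one.
    count-nz : ∀ {x e} → ¬ (dot e x ≈ 0#) → ∀ c → q * ∑ᵥ (λ h → nz (c +ᶠ dot h x)) ≡ K * q ^ v
    count-nz {x} {e} ex≉0 c = begin
      q * ∑ᵥ (λ h → nz (c +ᶠ dot h x))
        ≡⟨ ∑ᵥ-average (λ h≋ → nz-cong (F.+-congˡ (dot-cong h≋ (λ _ → ≈-refl)))) e ⟩
      ∑ᵥ (λ h → ∑ (λ i → nz (c +ᶠ dot (h +ᵥ elem i ·ᵥ e) x)))
        ≡⟨ ∑-cong (λ k → trans
             (∑-cong {q} (λ i → nz-cong (≈-trans (F.+-congˡ (dot-+·ˡ (enum k) (elem i) e x)) (≈-sym (F.+-assoc c _ _)))))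
             (∑-nz-affine (dot e x) (c +ᶠ dot (enum k) x) ex≉0)) ⟩
      ∑ {q ^ v} (λ _ → K)     ≡⟨ ∑-const (q ^ v) K ⟩
      q ^ v * K               ≡⟨ *-comm (q ^ v) K ⟩
      K * q ^ v               ∎
      where open ≡-Reasoning

    count-nz₀ : ∀ {x e} → ¬ (dot e x ≈ 0#) → q * ∑ᵥ (λ h → nz (dot h x)) ≡ K * q ^ v
    count-nz₀ {x} {e} ex≉0 = trans
      (cong (q *_) (∑-cong {q ^ v} (λ k → nz-cong (≈-sym (F.+-identityˡ (dot (enum k) x)))))) (count-nz {x} {e} ex≉0 0#)

    -- Says that x lies outside the span of y, hence for y ≠ 0 that the two are linearly
    -- independent. The witness `e` is the direction in which h can move so as to vary its product
    -- with x while fixing that with y.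
    Separated : V → V → Set _
    Separated x y = ∃ λ e → ¬ (dot e x ≈ 0#) × dot e y ≈ 0#

    -- Moving h along the separating direction keeps the factor of y constant, while the factor of x
    -- is nonzero for K of the q positions: the two events are independent.
    count-nz₂ : ∀ {x y} → Separated x y →
                q * ∑ᵥ (λ h → nz (dot h x) * nz (dot h y)) ≡ K * ∑ᵥ (λ h → nz (dot h y))
    count-nz₂ {x} {y} (e , ex≉0 , ey≈0) = begin
      q * ∑ᵥ (λ h → nz (dot h x) * nz (dot h y))
        ≡⟨ ∑ᵥ-average (λ h≋ → cong₂ _*_ (nz-cong (dot-cong h≋ (λ _ → ≈-refl)))
                                        (nz-cong (dot-cong h≋ (λ _ → ≈-refl)))) e ⟩
      ∑ᵥ (λ h → ∑ (λ i → nz (dot (h +ᵥ elem i ·ᵥ e) x) * nz (dot (h +ᵥ elem i ·ᵥ e) y)))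
        ≡⟨ ∑-cong {q ^ v} (λ k → fibre (enum k)) ⟩
      ∑ᵥ (λ h → K * nz (dot h y))      ≡⟨ *-distribˡ-∑ K (λ k → nz (dot (enum k) y)) ⟨
      K * ∑ᵥ (λ h → nz (dot h y))      ∎
      where
      open ≡-Reasoning
      fibre : ∀ h → ∑ (λ i → nz (dot (h +ᵥ elem i ·ᵥ e) x) * nz (dot (h +ᵥ elem i ·ᵥ e) y)) ≡ K * nz (dot h y)
      fibre h = begin
        ∑ (λ i → nz (dot (h +ᵥ elem i ·ᵥ e) x) * nz (dot (h +ᵥ elem i ·ᵥ e) y))
          ≡⟨ ∑-cong (λ i → cong₂ _*_ (nz-cong (dot-+·ˡ h (elem i) e x))
               (nz-cong (≈-trans (dot-+·ˡ h (elem i) e y)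
                 (≈-trans (F.+-congˡ (≈-trans (F.*-congˡ ey≈0) (F.zeroʳ _))) (F.+-identityʳ _))))) ⟩
        ∑ (λ i → nz (dot h x +ᶠ elem i *ᶠ dot e x) * nz (dot h y))
          ≡⟨ *-distribʳ-∑ (nz (dot h y)) (λ i → nz (dot h x +ᶠ elem i *ᶠ dot e x)) ⟨
        ∑ (λ i → nz (dot h x +ᶠ elem i *ᶠ dot e x)) * nz (dot h y)
          ≡⟨ cong (_* nz (dot h y)) (∑-nz-affine (dot e x) (dot h x) ex≉0) ⟩
        K * nz (dot h y) ∎

  -- Moments of the weight

  module _ {v M : ℕ} (x : Fin M → PG.V F v) where
    open PG F v using (V; 0ᵥ; _+ᵥ_; _·ᵥ_; linComb)

    private
      L : ℕ
      L = q ^ v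

    χ : Fin M → V → ℕ
    χ i h = nz (dot h (x i))

    -- s is the indicator function of a subset of the points, so that passing to
    -- a hyperplane section does not reindex the family.
    weight : (Fin M → ℕ) → V → ℕ
    weight s h = ∑ (λ i → s i * χ i h)

    ∑ᵥ-weight : ∀ s (f : V → ℕ) → ∑ᵥ (λ h → weight s h * f h) ≡ ∑ (λ i → s i * ∑ᵥ (λ h → χ i h * f h))
    ∑ᵥ-weight s f = begin
      ∑ᵥ (λ h → weight s h * f h)
        ≡⟨ ∑-cong {q ^ v} (λ k → *-distribʳ-∑ (f (enum k)) (λ i → s i * χ i (enum k))) ⟩
      ∑ᵥ (λ h → ∑ (λ i → s i * χ i h * f h))
        ≡⟨ ∑-comm (λ k i → s i * χ i (enum k) * f (enum k)) ⟩
      ∑ (λ i → ∑ᵥ (λ h → s i * χ i h * f h))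
        ≡⟨ ∑-cong {M} (λ i → trans
             (∑-cong {q ^ v} (λ k → *-assoc (s i) (χ i (enum k)) (f (enum k))))
             (sym (*-distribˡ-∑ (s i) (λ k → χ i (enum k) * f (enum k))))) ⟩
      ∑ (λ i → s i * ∑ᵥ (λ h → χ i h * f h)) ∎
      where open ≡-Reasoning

    pair-count : ∀ (x y : V) {e} → Separated x y → ¬ (dot e y ≈ 0#) →
                 q * q * ∑ᵥ (λ h → nz (dot h x) * nz (dot h y)) ≡ K * K * L
    pair-count x y {e} x∥y ey≉0 = begin
      q * q * ∑ᵥ (λ h → nz (dot h x) * nz (dot h y))
        ≡⟨ *-assoc q q (∑ᵥ (λ h → nz (dot h x) * nz (dot h y))) ⟩
      q * (q * ∑ᵥ (λ h → nz (dot h x) * nz (dot h y)))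
        ≡⟨ cong (q *_) (count-nz₂ {v} {x} {y} x∥y) ⟩
      q * (K * ∑ᵥ (λ h → nz (dot h y)))   ≡⟨ x∙yz≈y∙xz q K (∑ᵥ (λ h → nz (dot h y))) ⟩
      K * (q * ∑ᵥ (λ h → nz (dot h y)))   ≡⟨ cong (K *_) (count-nz₀ {v} {y} {e} ey≉0) ⟩
      K * (K * L)                         ≡⟨ *-assoc K K L ⟨
      K * K * L                           ∎
      where
      open ≡-Reasoning
      open CSG *-commutativeSemigroup using (x∙yz≈y∙xz)

    -- Correlates the weight with a point y outside the family. This serves `small⇒whole`, where
    -- such a point has to be excluded.
    cross-moment : ∀ s (y : V) {e} → (∀ i → Separated (x i) y) → ¬ (dot e y ≈ 0#) →
                   q * q * ∑ᵥ (λ h → weight s h * nz (dot h y)) ≡ K * K * L * ∑ s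
    cross-moment s y {e} sep ey≉0 = begin
      q * q * ∑ᵥ (λ h → weight s h * nz (dot h y))
        ≡⟨ cong (q * q *_) (∑ᵥ-weight s (λ h → nz (dot h y))) ⟩
      q * q * ∑ (λ i → s i * ∑ᵥ (λ h → χ i h * nz (dot h y)))
        ≡⟨ *-distribˡ-∑ (q * q) (λ i → s i * ∑ᵥ (λ h → χ i h * nz (dot h y))) ⟩
      ∑ (λ i → q * q * (s i * ∑ᵥ (λ h → χ i h * nz (dot h y))))
        ≡⟨ ∑-cong {M} (λ i → trans (x∙yz≈y∙xz (q * q) (s i) _) (trans
             (cong (s i *_) (pair-count (x i) y {e} (sep i) ey≉0)) (*-comm (s i) (K * K * L)))) ⟩
      ∑ (λ i → K * K * L * s i)   ≡⟨ *-distribˡ-∑ (K * K * L) s ⟨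
      K * K * L * ∑ s             ∎
      where
      open ≡-Reasoning
      open CSG *-commutativeSemigroup using (x∙yz≈y∙xz)

    restrict : (Fin M → ℕ) → V → Fin M → ℕ
    restrict s h i = s i * (1 ∸ χ i h)

    restrict-idem : ∀ {s} → (∀ i → s i * s i ≡ s i) → ∀ h i → restrict s h i * restrict s h i ≡ restrict s h i
    restrict-idem {s} idem h i with dot h (x i) ≈? 0#
    ... | yes _ = trans (cong₂ _*_ (*-identityʳ (s i)) (*-identityʳ (s i))) (trans (idem i) (sym (*-identityʳ (s i))))
    ... | no  _ = trans (cong (_* (s i * 0)) (*-zeroʳ (s i))) (sym (*-zeroʳ (s i)))

    ∑-restrict : ∀ s h → ∑ (restrict s h) + weight s h ≡ ∑ s
    ∑-restrict s h = trans (sym (∑-distrib-+ (restrict s h) (λ i → s i * χ i h)))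
      (∑-cong {M} (λ i → trans (sym (*-distribˡ-+ (s i) (1 ∸ χ i h) (χ i h)))
        (trans (cong (s i *_) (m∸n+n≡m (nz≤1 (dot h (x i))))) (*-identityʳ (s i)))))

    -- A point off the hyperplane of h sees an affine function of nonzero slope and counts K times.
    -- A point on it has the same product with all q functionals g + λ h.
    ∑-pencil : ∀ s h g → ∑ (λ l → weight s (g +ᵥ elem l ·ᵥ h)) ≡ K * weight s h + q * weight (restrict s h) g
    ∑-pencil s h g = begin
      ∑ (λ l → weight s (g +ᵥ elem l ·ᵥ h))
        ≡⟨ ∑-comm (λ l i → s i * χ i (g +ᵥ elem l ·ᵥ h)) ⟩
      ∑ (λ i → ∑ (λ l → s i * χ i (g +ᵥ elem l ·ᵥ h)))
        ≡⟨ ∑-cong {M} (λ i → trans (sym (*-distribˡ-∑ (s i) (λ l → χ i (g +ᵥ elem l ·ᵥ h)))) (pointwise i)) ⟩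
      ∑ (λ i → K * (s i * χ i h) + q * (restrict s h i * χ i g))
        ≡⟨ ∑-distrib-+ (λ i → K * (s i * χ i h)) (λ i → q * (restrict s h i * χ i g)) ⟩
      ∑ (λ i → K * (s i * χ i h)) + ∑ (λ i → q * (restrict s h i * χ i g))
        ≡⟨ cong₂ _+_ (*-distribˡ-∑ K (λ i → s i * χ i h)) (*-distribˡ-∑ q (λ i → restrict s h i * χ i g)) ⟨
      K * weight s h + q * weight (restrict s h) g ∎
      where
      open ≡-Reasoning
      fibre : ∀ i → ∑ (λ l → χ i (g +ᵥ elem l ·ᵥ h)) ≡ ∑ (λ l → nz (dot g (x i) F.+ elem l F.* dot h (x i)))
      fibre i = ∑-cong {q} (λ l → nz-cong (dot-+·ˡ g (elem l) h (x i)))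
      e₁ : ∀ a n K → a * (suc K * n) ≡ K * (a * 0) + suc K * (a * 1 * n)
      e₁ = solve-∀
      e₂ : ∀ a n K → a * K ≡ K * (a * 1) + suc K * (a * 0 * n)
      e₂ = solve-∀
      pointwise : ∀ i → s i * ∑ (λ l → χ i (g +ᵥ elem l ·ᵥ h)) ≡ K * (s i * χ i h) + q * (restrict s h i * χ i g)
      pointwise i with dot h (x i) ≈? 0#
      ... | yes hx≈0 = trans (cong (s i *_) (trans (fibre i) (∑-nz-const _ _ hx≈0))) (e₁ (s i) (χ i g) K)
      ... | no  hx≉0 = trans (cong (s i *_) (trans (fibre i) (∑-nz-affine _ _ hx≉0))) (e₂ (s i) (χ i g) K)

    -- In `∑-pencil` the left side and the first summand are multiples of q^(r + 1), hence so is the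
    -- last summand; cancelling its factor q costs exactly one power.
    restrict-divisible : ∀ {r s} → (∀ h → q ^ suc r ∣ weight s h) → ∀ h g → q ^ r ∣ weight (restrict s h) g
    restrict-divisible {r} {s} div h g = *-cancelˡ-∣ q
      (∣m+n∣m⇒∣n (subst (q ^ suc r ∣_) (∑-pencil s h g) (∣-∑ {n = q} _ (λ l → div (g +ᵥ elem l ·ᵥ h))))
        (∣n⇒∣m*n K (div h)))

    module _ (nonzero : ∀ i → ∃ λ e → ¬ (dot e (x i) ≈ 0#))
             (separated : ∀ {i j} → i ≢ j → Separated (x i) (x j)) where

      first-moment : ∀ s → q * ∑ᵥ (weight s) ≡ L * (K * ∑ s)
      first-moment s = begin
        q * ∑ᵥ (weight s)
          ≡⟨ cong (q *_) (trans (∑-cong {q ^ v} (λ k → sym (*-identityʳ (weight s (enum k))))) (∑ᵥ-weight s (λ _ → 1))) ⟩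
        q * ∑ (λ i → s i * ∑ᵥ (λ h → χ i h * 1))
          ≡⟨ *-distribˡ-∑ q (λ i → s i * ∑ᵥ (λ h → χ i h * 1)) ⟩
        ∑ (λ i → q * (s i * ∑ᵥ (λ h → χ i h * 1)))
          ≡⟨ ∑-cong {M} (λ i → trans (x∙yz≈y∙xz q (s i) _) (cong (s i *_)
               (trans (cong (q *_) (∑-cong {q ^ v} (λ k → *-identityʳ (χ i (enum k)))))
                 (count-nz₀ {v} {e = proj₁ (nonzero i)} (proj₂ (nonzero i)))))) ⟩
        ∑ (λ i → s i * (K * L))     ≡⟨ *-distribʳ-∑ (K * L) s ⟨
        ∑ s * (K * L)               ≡⟨ lem (∑ s) K L ⟩
        L * (K * ∑ s)               ∎
        where
        open ≡-Reasoning
        open CSG *-commutativeSemigroup using (x∙yz≈y∙xz)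
        lem : ∀ n K L → n * (K * L) ≡ L * (K * n)
        lem = solve-∀

      module _ (s : Fin M → ℕ) (idem : ∀ i → s i * s i ≡ s i) where

        -- Every i ≠ j contributes K K L by independence, whereas i = j contributes q K L = K K L +
        -- K L because `nz` is idempotent. The surplus K L is the origin of the linear term in
        -- `second-moment`. The factor `s j` is carried along so that `idem` can absorb its square.
        diagonal : ∀ j → q * q * (s j * ∑ᵥ (λ h → weight s h * χ j h)) ≡ s j * (L * (K * K * ∑ s + K))
        diagonal j = begin
          q * q * (s j * ∑ᵥ (λ h → weight s h * χ j h))
            ≡⟨ cong (λ n → q * q * (s j * n)) (∑ᵥ-weight s (χ j)) ⟩
          q * q * (s j * ∑ (λ i → s i * T i))
            ≡⟨ trans (x∙yz≈y∙xz (q * q) (s j) _) (cong (s j *_) (trans (*-distribˡ-∑ (q * q) (λ i → s i * T i))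
                 (∑-cong {M} (λ i → x∙yz≈y∙xz (q * q) (s i) _)))) ⟩
          s j * ∑ (λ i → s i * (q * q * T i))
            ≡⟨ cong (s j *_) (at-j (λ i → q * q * T i) off) ⟩
          s j * (s j * (q * q * T j) + (rest * (K * K * L)))
            ≡⟨ cong (λ n → s j * (s j * n + rest * (K * K * L))) on ⟩
          s j * (s j * (q * (K * L)) + rest * (K * K * L))
            ≡⟨ split (s j) K L rest ⟩
          s j * s j * (K * L) + s j * ((s j + rest) * (K * K * L))
            ≡⟨ cong₂ (λ a n → a * (K * L) + s j * (n * (K * K * L))) (idem j) (sym total) ⟩
          s j * (K * L) + s j * (∑ s * (K * K * L))
            ≡⟨ collect (s j) (∑ s) K L ⟩
          s j * (L * (K * K * ∑ s + K)) ∎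
          where
          open ≡-Reasoning
          open CSG *-commutativeSemigroup using (x∙yz≈y∙xz)
          T : Fin M → ℕ
          T i = ∑ᵥ (λ h → χ i h * χ j h)
          rest : ℕ
          rest = ∑ s ∸ s j
          at : ∀ {m} (j : Fin m) (s f : Fin m → ℕ) c → (∀ {i} → i ≢ j → f i ≡ c) →
               ∑ (λ i → s i * f i) ≡ s j * f j + (∑ s ∸ s j) * c
          at {suc m} j s f c f≡c = begin
            ∑ (λ i → s i * f i)
              ≡⟨ ∑-remove {i = j} (λ i → s i * f i) ⟩
            s j * f j + ∑ (removeAt (λ i → s i * f i) j)
              ≡⟨ cong (s j * f j +_) (∑-cong {m} (λ i → cong (s (punchIn j i) *_) (f≡c (Fin.punchInᵢ≢i j i)))) ⟩
            s j * f j + ∑ (λ i → s (punchIn j i) * c)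
              ≡⟨ cong (s j * f j +_) (*-distribʳ-∑ c (λ i → s (punchIn j i))) ⟨
            s j * f j + ∑ (removeAt s j) * c
              ≡⟨ cong (λ n → s j * f j + n * c) (trans (sym (m+n∸m≡n (s j) _)) (cong (_∸ s j) (sym (∑-remove {i = j} s)))) ⟩
            s j * f j + (∑ s ∸ s j) * c ∎
          at-j : ∀ f → (∀ {i} → i ≢ j → f i ≡ K * K * L) →
                 ∑ (λ i → s i * f i) ≡ s j * f j + rest * (K * K * L)
          at-j f = at j s f (K * K * L)
          off : ∀ {i} → i ≢ j → q * q * T i ≡ K * K * L
          off {i} i≢j = pair-count (x i) (x j) {proj₁ (nonzero j)} (separated i≢j) (proj₂ (nonzero j))
          on : q * q * T j ≡ q * (K * L)
          on = trans (*-assoc q q (T j)) (cong (q *_)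
            (trans (cong (q *_) (∑-cong {q ^ v} (λ k → nz-idem (dot (enum k) (x j)))))
              (count-nz₀ {v} {e = proj₁ (nonzero j)} (proj₂ (nonzero j)))))
          sj≤ : ∀ {m} (j : Fin m) (s : Fin m → ℕ) → s j ≤ ∑ s
          sj≤ {suc m} j s = subst (s j ≤_) (sym (∑-remove {i = j} s)) (m≤m+n (s j) _)
          total : ∑ s ≡ s j + rest
          total = sym (m+[n∸m]≡n (sj≤ j s))
          split : ∀ a K L r → a * (a * (suc K * (K * L)) + r * (K * K * L))
                ≡ a * a * (K * L) + a * ((a + r) * (K * K * L))
          split = solve-∀
          collect : ∀ a n K L → a * (K * L) + a * (n * (K * K * L)) ≡ a * (L * (K * K * n + K))
          collect = solve-∀

        second-moment : let X = K * ∑ s in q * q * ∑ᵥ (λ h → weight s h * weight s h) ≡ L * (X * X + X)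
        second-moment = begin
          q * q * ∑ᵥ (λ h → weight s h * weight s h)
            ≡⟨ cong (q * q *_) (trans (∑ᵥ-weight s (weight s)) (∑-cong {M} (λ i → cong (s i *_)
                 (∑-cong {q ^ v} (λ k → *-comm (χ i (enum k)) _))))) ⟩
          q * q * ∑ (λ i → s i * ∑ᵥ (λ h → weight s h * χ i h))
            ≡⟨ *-distribˡ-∑ (q * q) (λ i → s i * ∑ᵥ (λ h → weight s h * χ i h)) ⟩
          ∑ (λ i → q * q * (s i * ∑ᵥ (λ h → weight s h * χ i h)))
            ≡⟨ ∑-cong {M} diagonal ⟩
          ∑ (λ i → s i * (L * (K * K * ∑ s + K)))
            ≡⟨ *-distribʳ-∑ (L * (K * K * ∑ s + K)) s ⟨
          ∑ s * (L * (K * K * ∑ s + K))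
            ≡⟨ lem (∑ s) K L ⟩
          L * (K * ∑ s * (K * ∑ s) + K * ∑ s) ∎
          where
          open ≡-Reasoning
          lem : ∀ n K L → n * (L * (K * K * n + K)) ≡ L * (K * n * (K * n) + K * n)
          lem = solve-∀

      divisible⇒¬gap : ∀ r s → (∀ i → s i * s i ≡ s i) → (∀ h → q ^ r ∣ weight s h) → ¬ Gap K r (∑ s)
      -- For r = 0 no a satisfies a < r, so the descent ends with no interval left.
      divisible⇒¬gap zero    s idem div (gap _ _ _ () _ _ _)
      divisible⇒¬gap (suc r) s idem div (gap a b y a<r b<K n≡ y<) = go (a <? y)
        where
        N = a * K + b
        D = q ^ suc r
        X = K * ∑ s
        t : V → ℕ
        t h = _∣_.quotient (div h)
        w≡tD : ∀ h → weight s h ≡ t h * D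
        w≡tD h = _∣_.equality (div h)

        go : Dec (a < y) → ⊥
        go (yes a<y) = second-moment-fails {r = r} a<r b<K a<y n≡ y< (*-cancelˡ-≤ L {{m^n≢0 q v}} (begin
          L * ((2 * N + 1) * (q * D * X))
            ≡⟨ e₁ L N q D X ⟩
          (2 * N + 1) * (q * D) * (L * X)
            ≡⟨ cong ((2 * N + 1) * (q * D) *_) (trans (sym (first-moment s)) (cong (q *_) ∑w)) ⟩
          (2 * N + 1) * (q * D) * (q * (∑ᵥ t * D))
            ≡⟨ e₂ N q D (∑ᵥ t) ⟩
          q * q * (D * D) * ((2 * N + 1) * ∑ᵥ t)
            ≤⟨ *-monoʳ-≤ (q * q * (D * D)) ∑-between ⟩
          q * q * (D * D) * (∑ᵥ (λ h → t h * t h) + L * (N * suc N))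
            ≡⟨ e₃ q D L N (∑ᵥ (λ h → t h * t h)) ⟩
          q * q * (∑ᵥ (λ h → t h * t h) * (D * D)) + L * (N * suc N * (q * D * (q * D)))
            ≡⟨ cong (_+ L * (N * suc N * (q * D * (q * D)))) (trans (cong (q * q *_) (sym ∑ww)) (second-moment s idem)) ⟩
          L * (X * X + X) + L * (N * suc N * (q * D * (q * D)))
            ≡⟨ *-distribˡ-+ L (X * X + X) _ ⟨
          L * (X * X + X + N * suc N * (q * D * (q * D))) ∎))
          where
          open ≤-Reasoning
          e₁ : ∀ L N q D X → L * ((2 * N + 1) * (q * D * X)) ≡ (2 * N + 1) * (q * D) * (L * X)
          e₁ = solve-∀
          e₂ : ∀ N q D T → (2 * N + 1) * (q * D) * (q * (T * D)) ≡ q * q * (D * D) * ((2 * N + 1) * T)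
          e₂ = solve-∀
          e₃ : ∀ q D L N T → q * q * (D * D) * (T + L * (N * suc N))
             ≡ q * q * (T * (D * D)) + L * (N * suc N * (q * D * (q * D)))
          e₃ = solve-∀
          e₄ : ∀ t D → t * D * (t * D) ≡ t * t * (D * D)
          e₄ = solve-∀
          ∑w : ∑ᵥ (weight s) ≡ ∑ᵥ t * D
          ∑w = trans (∑-cong {q ^ v} (λ k → w≡tD (enum k))) (sym (*-distribʳ-∑ D (λ k → t (enum k))))
          ∑ww : ∑ᵥ (λ h → weight s h * weight s h) ≡ ∑ᵥ (λ h → t h * t h) * (D * D)
          ∑ww = trans
            (∑-cong {q ^ v} (λ k → trans (cong₂ _*_ (w≡tD (enum k)) (w≡tD (enum k))) (e₄ (t (enum k)) D)))
            (sym (*-distribʳ-∑ (D * D) (λ k → t (enum k) * t (enum k))))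
          ∑-between : (2 * N + 1) * ∑ᵥ t ≤ ∑ᵥ (λ h → t h * t h) + L * (N * suc N)
          ∑-between = begin
            (2 * N + 1) * ∑ᵥ t                            ≡⟨ *-distribˡ-∑ (2 * N + 1) (λ k → t (enum k)) ⟩
            ∑ᵥ (λ h → (2 * N + 1) * t h)                  ≤⟨ ∑-mono {q ^ v} (λ k → integer-between N (t (enum k))) ⟩
            ∑ᵥ (λ h → t h * t h + N * suc N)              ≡⟨ ∑-distrib-+ {q ^ v} (λ k → t (enum k) * t (enum k)) (λ _ → N * suc N) ⟩
            ∑ᵥ (λ h → t h * t h) + ∑ {q ^ v} (λ _ → N * suc N)
              ≡⟨ cong (∑ᵥ (λ h → t h * t h) +_) (∑-const (q ^ v) (N * suc N)) ⟩
            ∑ᵥ (λ h → t h * t h) + L * (N * suc N)        ∎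

        go (no a≮y) with Fin.any? (λ k → suc N ≤? t (enum k))
        ... | yes (k , N<t) with σ , N+σ≡t ← m≤n⇒∃[o]m+o≡n N<t =
          divisible⇒¬gap r (restrict s h) (restrict-idem idem h) (restrict-divisible {r} {s} div h)
            (gap-descends {r = r} σ a<r b<K (≮⇒≥ a≮y) (begin
              ∑ (restrict s h) + D * (N + suc σ)
                ≡⟨ cong (λ n → ∑ (restrict s h) + D * n) (trans (+-suc N σ) N+σ≡t) ⟩
              ∑ (restrict s h) + D * t h
                ≡⟨ cong (∑ (restrict s h) +_) (trans (*-comm D (t h)) (sym (w≡tD h))) ⟩
              ∑ (restrict s h) + weight s h
                ≡⟨ ∑-restrict s h ⟩
              ∑ s
                ≡⟨ n≡ ⟩
              N * geo K (2 + r) + (a + 1 + y) ∎))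
          where
          open ≡-Reasoning
          h = enum k
        ... | no ¬N<t = average-exceeds {a = a} y (geo K (2 + r)) b<K
          (subst₂ _≤_ (cong (K *_) n≡) (cong (_* N) (pow-geo K (2 + r))) (*-cancelˡ-≤ L {{m^n≢0 q v}} (begin
            L * X                             ≡⟨ first-moment s ⟨
            q * ∑ᵥ (weight s)                 ≤⟨ *-monoʳ-≤ q (∑-mono {q ^ v} bound) ⟩
            q * ∑ {q ^ v} (λ _ → N * D)       ≡⟨ cong (q *_) (∑-const (q ^ v) (N * D)) ⟩
            q * (L * (N * D))                 ≡⟨ e q L N D ⟩
            L * (q * D * N)                   ∎)))
          where
          open ≤-Reasoning
          bound : ∀ k → weight s (enum k) ≤ N * D
          bound k = subst (_≤ N * D) (sym (w≡tD (enum k)))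
            (*-monoˡ-≤ D (≮⇒≥ (λ N<t → ¬N<t (k , N<t))))
          e : ∀ q L N D → q * (L * (N * D)) ≡ L * (q * D * N)
          e = solve-∀

  -- Points and hyperplanes

  sum-single : ∀ {n} (f : Fin n → Carrier) i → (∀ {j} → j ≢ i → f j ≈ 0#) → sumᶠ f ≈ f i
  sum-single {suc n} f i f≈0 = ≈-trans (Sumᶠ.sum-remove {i = i} f)
    (≈-trans (F.+-congˡ (≈-trans (Sumᶠ.sum-cong-≋ (λ j → f≈0 (Fin.punchInᵢ≢i i j))) (Sumᶠ.sum-replicate-zero n)))
      (F.+-identityʳ (f i)))

  module _ {v : ℕ} where
    open PG F v using (V; 0ᵥ; _+ᵥ_; _·ᵥ_; linComb)

    δ : Fin v → V
    δ i j with i Fin.≟ j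
    ... | yes _ = 1#
    ... | no  _ = 0#

    δ-refl : ∀ i → δ i i ≈ 1#
    δ-refl i with i Fin.≟ i
    ... | yes _  = ≈-refl
    ... | no i≢i = contradiction refl i≢i

    δ-≢ : ∀ {i j} → i ≢ j → δ i j ≈ 0#
    δ-≢ {i} {j} i≢j with i Fin.≟ j
    ... | yes i≡j = contradiction i≡j i≢j
    ... | no  _   = ≈-refl

    dot-δ : ∀ i x → dot (δ i) x ≈ x i
    dot-δ i x = ≈-trans
      (sum-single (λ j → δ i j *ᶠ x j) i (λ j≢i → ≈-trans (F.*-congʳ (δ-≢ (j≢i ∘ sym))) (F.zeroˡ _)))
      (≈-trans (F.*-congʳ (δ-refl i)) (F.*-identityˡ (x i)))

    infix 4 _≋?_
    _≋?_ : ∀ (x y : V) → Dec (x ≋ y)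
    x ≋? y = Fin.all? (λ i → x i ≈? y i)

    nonzero-coordinate : ∀ {x : V} → ¬ (x ≋ 0ᵥ) → ∃ λ k → ¬ (x k ≈ 0#)
    nonzero-coordinate {x} x≉0 = Fin.¬∀⟶∃¬ v (λ i → x i ≈ 0#) (λ i → x i ≈? 0#) x≉0

    nonzero⇒dot : ∀ {x} → ¬ (x ≋ 0ᵥ) → ∃ λ e → ¬ (dot e x ≈ 0#)
    nonzero⇒dot {x} x≉0 with k , xk≉0 ← nonzero-coordinate x≉0 =
      δ k , λ eq → xk≉0 (≈-trans (≈-sym (dot-δ k x)) eq)

    -- Fix k with y_k ≠ 0 and look at the minors y_k x_l - y_l x_k. A nonzero one is the value at x
    -- of a functional that kills y; if all vanish, then x = (x_k / y_k) y.
    separated⊎proportional : ∀ x {y} → ¬ (y ≋ 0ᵥ) → Separated x y ⊎ ∃ λ a → x ≋ a ·ᵥ y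
    separated⊎proportional x {y} y≉0
      with k , yk≉0 ← nonzero-coordinate y≉0
      with Fin.any? (λ l → ¬? (y k *ᶠ x l +ᶠ -ᶠ (y l) *ᶠ x k ≈? 0#))
    ... | yes (l , x∤y) = inj₁ (e , (λ eq → x∤y (≈-trans (≈-sym (dot-e x)) eq)) ,
            ≈-trans (dot-e y) (≈-trans (F.+-cong (F.*-comm (y k) (y l)) (≈-sym (-‿distribˡ-* (y l) (y k)))) (F.-‿inverseʳ _)))
      where
      open RingProps ring using (-‿distribˡ-*)
      e : V
      e = y k ·ᵥ δ l +ᵥ (-ᶠ (y l)) ·ᵥ δ k
      dot-e : ∀ z → dot e z ≈ y k *ᶠ z l +ᶠ -ᶠ (y l) *ᶠ z k
      dot-e z = ≈-trans (dot-+·ˡ (y k ·ᵥ δ l) (-ᶠ (y l)) (δ k) z)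
        (F.+-cong (≈-trans (dot-·ˡ (y k) (δ l) z) (F.*-congˡ (dot-δ l z))) (F.*-congˡ (dot-δ k z)))
    ... | no none = inj₂ (yk⁻¹ *ᶠ x k , prop)
      where
      yk⁻¹ = proj₁ (inverse (y k) yk≉0)
      open RingProps ring using (-‿distribˡ-*)
      open SetoidReasoning setoid
      prop : ∀ l → x l ≈ yk⁻¹ *ᶠ x k *ᶠ y l
      prop l = *-cancelˡ-≈ yk≉0 (begin
        y k *ᶠ x l                    ≈⟨ x-y≈0⇒x≈y (≈-trans (F.+-congˡ (-‿distribˡ-* (y l) (x k)))
                                            (decidable-stable (_ ≈? _) (λ ≉ → none (l , ≉)))) ⟩
        y l *ᶠ x k                    ≈⟨ F.*-comm (y l) (x k) ⟩
        x k *ᶠ y l                    ≈⟨ F.*-congʳ (F.*-identityˡ (x k)) ⟨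
        1# *ᶠ x k *ᶠ y l              ≈⟨ F.*-congʳ (F.*-congʳ (≈-trans (F.*-comm (y k) yk⁻¹) (proj₂ (inverse (y k) yk≉0)))) ⟨
        y k *ᶠ yk⁻¹ *ᶠ x k *ᶠ y l     ≈⟨ F.*-congʳ (F.*-assoc (y k) yk⁻¹ (x k)) ⟩
        y k *ᶠ (yk⁻¹ *ᶠ x k) *ᶠ y l   ≈⟨ F.*-assoc (y k) (yk⁻¹ *ᶠ x k) (y l) ⟩
        y k *ᶠ (yk⁻¹ *ᶠ x k *ᶠ y l)   ∎)

    separated⇒≉ : ∀ {x y : V} → Separated x y → ¬ (x ≋ y)
    separated⇒≉ (e , ex≉0 , ey≈0) x≋y = ex≉0 (≈-trans (dot-cong {h = e} (λ _ → ≈-refl) x≋y) ey≈0)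

  module _ {v : ℕ} (h : PG.V F (suc v)) {k} (hk≉0 : ¬ (h k ≈ 0#)) where
    open PG F (suc v)

    -- A vector of the hyperplane is determined by its coordinates other than
    -- the k-th, because h k is invertible.
    perp-ext : ∀ {x y} → dot h x ≈ dot h y → (∀ j → x (punchIn k j) ≈ y (punchIn k j)) → x ≋ y
    perp-ext {x} {y} hx≈hy agree j with k Fin.≟ j
    ... | no k≢j = subst (λ j → x j ≈ y j) (Fin.punchIn-punchOut k≢j) (agree (punchOut k≢j))
    ... | yes refl = *-cancelˡ-≈ hk≉0 (RingProps.+-cancelʳ ring (rest y) _ _ (begin
      h k *ᶠ x k +ᶠ rest y    ≈⟨ F.+-congˡ (Sumᶠ.sum-cong-≋ (λ j → F.*-congˡ (agree j))) ⟨
      h k *ᶠ x k +ᶠ rest x    ≈⟨ Sumᶠ.sum-remove {i = k} (λ j → h j *ᶠ x j) ⟨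
      dot h x                 ≈⟨ hx≈hy ⟩
      dot h y                 ≈⟨ Sumᶠ.sum-remove {i = k} (λ j → h j *ᶠ y j) ⟩
      h k *ᶠ y k +ᶠ rest y    ∎))
      where
      open SetoidReasoning setoid
      rest : V → Carrier
      rest z = sumᶠ (λ j → h (punchIn k j) *ᶠ z (punchIn k j))

    private
      hk⁻¹ = proj₁ (inverse (h k) hk≉0)

      -- Unit vectors away from coordinate k, with the entry at k solved from orthogonality to h.
      basis : Fin v → V
      basis i j with k Fin.≟ j
      ... | yes _  = -ᶠ (h (punchIn k i) *ᶠ hk⁻¹)
      ... | no k≢j = δ i (punchOut k≢j)

      basis-k : ∀ i → basis i k ≈ -ᶠ (h (punchIn k i) *ᶠ hk⁻¹)
      basis-k i with k Fin.≟ k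
      ... | yes _  = ≈-refl
      ... | no k≢k = contradiction refl k≢k

      basis-punchIn : ∀ i j → basis i (punchIn k j) ≈ δ i j
      basis-punchIn i j with k Fin.≟ punchIn k j
      ... | yes k≡ = contradiction (sym k≡) (Fin.punchInᵢ≢i k j)
      ... | no k≢  = F.reflexive (cong (δ i) (trans (Fin.punchOut-cong k refl) (Fin.punchOut-punchIn k)))

      linComb-punchIn : ∀ a j → linComb a basis (punchIn k j) ≈ a j
      linComb-punchIn a j = ≈-trans
        (sum-single (λ i → a i *ᶠ basis i (punchIn k j)) j
          (λ {i} i≢j → ≈-trans (F.*-congˡ (≈-trans (basis-punchIn i j) (δ-≢ i≢j))) (F.zeroʳ (a i))))
        (≈-trans (F.*-congˡ (≈-trans (basis-punchIn j j) (δ-refl j))) (F.*-identityʳ (a j)))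

      basis-perp : ∀ i → dot h (basis i) ≈ 0#
      basis-perp i = begin
        dot h (basis i)
          ≈⟨ Sumᶠ.sum-remove {i = k} (λ j → h j *ᶠ basis i j) ⟩
        h k *ᶠ basis i k +ᶠ sumᶠ (λ j → h (punchIn k j) *ᶠ basis i (punchIn k j))
          ≈⟨ F.+-cong (F.*-congˡ (basis-k i)) (sum-single _ i
               (λ {j} j≢i → ≈-trans (F.*-congˡ (≈-trans (basis-punchIn i j) (δ-≢ (j≢i ∘ sym)))) (F.zeroʳ _))) ⟩
        h k *ᶠ (-ᶠ (h (punchIn k i) *ᶠ hk⁻¹)) +ᶠ h (punchIn k i) *ᶠ basis i (punchIn k i)
          ≈⟨ F.+-cong (≈-trans (≈-sym (-‿distribʳ-* (h k) _)) (F.-‿cong (≈-trans (F.*-comm (h k) _)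
                 (≈-trans (F.*-assoc _ hk⁻¹ (h k)) (≈-trans (F.*-congˡ (proj₂ (inverse (h k) hk≉0))) (F.*-identityʳ _))))))
               (≈-trans (F.*-congˡ (≈-trans (basis-punchIn i i) (δ-refl i))) (F.*-identityʳ _)) ⟩
        -ᶠ (h (punchIn k i)) +ᶠ h (punchIn k i)
          ≈⟨ F.-‿inverseˡ _ ⟩
        0# ∎
        where
        open SetoidReasoning setoid
        open RingProps ring using (-‿distribʳ-*)

      linComb-perp : ∀ a → dot h (linComb a basis) ≈ 0#
      linComb-perp a = ≈-trans (dot-linComb h a basis)
        (≈-trans (Sumᶠ.sum-cong-≋ (λ i → ≈-trans (F.*-congˡ (basis-perp i)) (F.zeroʳ (a i)))) (Sumᶠ.sum-replicate-zero v))

    perp : Hyperplane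
    perp = record
      { Mem      = λ x → Lift (c ⊔ˡ ℓ) (dot h x ≈ 0#)
      ; resp     = λ x≋y hx → lift (≈-trans (dot-cong {h = h} (λ _ → ≈-refl) (λ i → ≈-sym (x≋y i))) (lower hx))
      ; 0-mem    = lift (dot-0ʳ h (λ _ → ≈-refl))
      ; +-closed = λ {x} {y} hx hy → lift (≈-trans (dot-+ʳ h x y) (≈-trans (F.+-cong (lower hx) (lower hy)) (F.+-identityˡ 0#)))
      ; ·-closed = λ a {x} hx → lift (≈-trans (dot-·ʳ a h x) (≈-trans (F.*-congˡ (lower hx)) (F.zeroʳ a)))
      } , record
      { basis       = basis
      ; basis-mem   = λ i → lift (basis-perp i)
      ; independent = λ a eq i → ≈-trans (≈-sym (linComb-punchIn a i)) (eq (punchIn k i))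
      ; spanning    = λ {x} hx → (λ i → x (punchIn k i)) ,
          perp-ext (≈-trans (lower hx) (≈-sym (linComb-perp _))) (λ j → ≈-sym (linComb-punchIn _ j))
      }

  module _ {v : ℕ} where
    open PG F v

    generator : Point → V
    generator (_ , d) = HasDimension.basis d zero

    module _ (P : Point) where
      private module D = HasDimension (proj₂ P)

      linComb₁ : ∀ (a : Vector Carrier 1) → linComb a D.basis ≋ a zero ·ᵥ generator P
      linComb₁ a j = F.+-identityʳ _

      generator-mem : Mem (proj₁ P) (generator P)
      generator-mem = D.basis-mem zero

      generator≉0 : ¬ (generator P ≋ 0ᵥ)
      generator≉0 eq = 1≉0 (D.independent (λ _ → 1#)
        (λ j → ≈-trans (linComb₁ (λ _ → 1#) j) (≈-trans (F.*-congˡ (eq j)) (F.zeroʳ 1#))) zero)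

      mem⇒multiple : ∀ {y} → Mem (proj₁ P) y → ∃ λ a → y ≋ a ·ᵥ generator P
      mem⇒multiple y∈P with a , eq ← D.spanning y∈P = a zero , λ j → ≈-trans (eq j) (linComb₁ a j)

    ⊆⇒mem : ∀ (P : Point) (W : Subspace) → Mem W (generator P) → ∀ {y} → Mem (proj₁ P) y → Mem W y
    ⊆⇒mem P W g∈W y∈P with a , eq ← mem⇒multiple P y∈P =
      Subspace.resp W (λ j → ≈-sym (eq j)) (Subspace.·-closed W a g∈W)

    multiple⇒nonzero : ∀ {a x} {y : V} → ¬ (x ≋ 0ᵥ) → x ≋ a ·ᵥ y → ¬ (a ≈ 0#)
    multiple⇒nonzero x≉0 eq a≈0 = x≉0 (λ j → ≈-trans (eq j) (≈-trans (F.*-congʳ a≈0) (F.zeroˡ _)))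

    ·ᵥ-cancel : ∀ {a b} {x y : V} → b *ᶠ a ≈ 1# → x ≋ a ·ᵥ y → y ≋ b ·ᵥ x
    ·ᵥ-cancel {a} {b} {x} {y} ba≈1 eq j = begin
      y j                  ≈⟨ F.*-identityˡ (y j) ⟨
      1# *ᶠ y j            ≈⟨ F.*-congʳ ba≈1 ⟨
      b *ᶠ a *ᶠ y j        ≈⟨ F.*-assoc b a (y j) ⟩
      b *ᶠ (a *ᶠ y j)      ≈⟨ F.*-congˡ (eq j) ⟨
      b *ᶠ x j             ∎
      where open SetoidReasoning setoid

    proportional⇒≈ₚ : ∀ P Q {a} → generator P ≋ a ·ᵥ generator Q → P ≈ₚ Q
    proportional⇒≈ₚ P Q {a} eq with b , ba≈1 ← inverse a (multiple⇒nonzero (generator≉0 P) eq) =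
      ⊆⇒mem P (proj₁ Q) (Subspace.resp (proj₁ Q) (λ j → ≈-sym (eq j))
        (Subspace.·-closed (proj₁ Q) a (generator-mem Q))) ,
      ⊆⇒mem Q (proj₁ P) (Subspace.resp (proj₁ P) (λ j → ≈-sym (·ᵥ-cancel ba≈1 eq j))
        (Subspace.·-closed (proj₁ P) b (generator-mem P)))

  -- Weights of a divisible point set

  module _ {v : ℕ} (C : PG.PointSet F (suc v)) {n : ℕ} (∣C∣≡n : PG.∣_∣≡_ F (suc v) C n) where
    open PG F (suc v)
    private module Card = Inverse ∣C∣≡n

    point : Fin n → Point
    point i = proj₁ (Card.from i)

    vectors : Fin n → V
    vectors i = generator (point i)

    vectors-nonzero : ∀ i → ∃ λ e → ¬ (dot e (vectors i) ≈ 0#)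
    vectors-nonzero i = nonzero⇒dot (generator≉0 (point i))

    vectors-separated : ∀ {i j} → i ≢ j → Separated (vectors i) (vectors j)
    vectors-separated {i} {j} i≢j with separated⊎proportional (vectors i) (generator≉0 (point j))
    ... | inj₁ sep      = sep
    ... | inj₂ (a , eq) = contradiction
      (trans (sym (Card.strictlyInverseˡ i))
        (trans (Card.to-cong (proportional⇒≈ₚ (point i) (point j) eq)) (Card.strictlyInverseˡ j)))
      i≢j

    1s : Fin n → ℕ
    1s _ = 1

    ∑1s : ∑ 1s ≡ n
    ∑1s = trans (∑-const n 1) (*-identityʳ n)

    wt : V → ℕ
    wt = weight vectors 1s

    -- The section comes with a bijection of its own, unrelated to that of C. Including the section
    -- in C gives an injection of `Fin m` into `Fin n`, whose image consists of the indices where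
    -- `wt` counts nothing.
    ∣C∩perp∣ : ∀ h {k} (hk≉0 : ¬ (h k ≈ 0#)) {m} → ∣ C ∩ perp h hk≉0 ∣≡ m → m + wt h ≡ n
    ∣C∩perp∣ h {k} hk≉0 {m} card = begin
      m + wt h
        ≡⟨ cong (_+ wt h) (∑-image f (restrict vectors 1s h) f-inj on off) ⟨
      ∑ (restrict vectors 1s h) + wt h
        ≡⟨ ∑-restrict vectors 1s h ⟩
      ∑ 1s
        ≡⟨ ∑1s ⟩
      n ∎
      where
      open ≡-Reasoning
      module Sub = Inverse card
      H = perp h hk≉0
      include : Σ Point (Has (C ∩ H)) → Σ Point (Has C)
      include (P , P∈C , _) = P , P∈C
      f : Fin m → Fin n
      f i = Card.to (include (Sub.from i))
      f-inj : ∀ {i j} → f i ≡ f j → i ≡ j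
      f-inj {i} {j} eq = trans (sym (Sub.strictlyInverseˡ i))
        (trans (Sub.to-cong {Sub.from i} {Sub.from j}
            (Injection.injective (Inverse⇒Injection ∣C∣≡n) {include (Sub.from i)} {include (Sub.from j)} eq))
          (Sub.strictlyInverseˡ j))
      on : ∀ i → 1 * (1 ∸ nz (dot h (vectors (f i)))) ≡ 1
      on i = cong (λ z → 1 * (1 ∸ z)) (nz-zero (lower (proj₂ (proj₂ (Sub.from i))
        (proj₁ (Card.strictlyInverseʳ (include (Sub.from i))) (generator-mem (point (f i)))))))
      off : ∀ j → (∀ i → f i ≢ j) → 1 * (1 ∸ nz (dot h (vectors j))) ≡ 0
      off j none = cong (λ z → 1 * (1 ∸ z)) (nz-nonzero λ hx≈0 →
        let Q : Σ Point (Has (C ∩ H))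
            Q = point j , proj₂ (Card.from j) , ⊆⇒mem (point j) (proj₁ H) (lift hx≈0)
        in none (Sub.to Q) (trans (Card.to-cong {include (Sub.from (Sub.to Q))} {Card.from j} (Sub.strictlyInverseʳ Q))
             (Card.strictlyInverseˡ j)))

    wt-0 : ∀ {h} → h ≋ 0ᵥ → wt h ≡ 0
    wt-0 {h} h≋0 = trans
      (∑-cong {n} (λ i → cong (1 *_) (nz-zero (dot-0ˡ (vectors i) h≋0))))
      (trans (∑-const n 0) (*-zeroʳ n))

    wt≤n : ∀ h → wt h ≤ n
    wt≤n h = subst (wt h ≤_) (trans (∑-restrict vectors 1s h) ∑1s) (m≤n+m (wt h) _)

    private
      i₀ : Fin (q ^ suc v)
      i₀ = index 0ᵥ

      -- The zero vector defines no hyperplane, and `wt` is 0 there. Putting w in that place extends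
      -- a property of all nonzero h to every vector, so that it can be summed.
      padded : ℕ → Fin (q ^ suc v) → ℕ
      padded w i = wt (enum i) + [ i₀ ≟ i ] * w

      padded-i₀ : ∀ w → padded w i₀ ≡ w
      padded-i₀ w = trans (cong₂ (λ a b → a + b * w) (wt-0 (enum-index 0ᵥ)) ([≟]-refl i₀)) (+-identityʳ w)

      padded-≢ : ∀ w {i} → i₀ ≢ i → padded w i ≡ wt (enum i)
      padded-≢ w {i} i₀≢i = trans (cong (λ b → wt (enum i) + b * w) ([≟]-≢ i₀≢i)) (+-identityʳ _)

      enum≉0 : ∀ {i} → i₀ ≢ i → ¬ (enum {suc v} i ≋ 0ᵥ)
      enum≉0 {i} i₀≢i eq = i₀≢i (trans (index-cong (λ j → ≈-sym (eq j))) (index-enum {suc v} i))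

      padded-elim : ∀ (P : ℕ → Set) w → P w → (∀ {h} → ¬ (h ≋ 0ᵥ) → P (wt h)) → ∀ i → P (padded w i)
      padded-elim P w P[w] P[wt] i = go (i₀ Fin.≟ i)
        where
        go : Dec (i₀ ≡ i) → P (padded w i)
        go (yes refl) = subst P (sym (padded-i₀ w)) P[w]
        go (no  i₀≢i) = subst P (sym (padded-≢ w i₀≢i)) (P[wt] (enum≉0 i₀≢i))

      ∑-padded : ∀ w → ∑ (padded w) ≡ ∑ᵥ wt + w
      ∑-padded w = trans (∑-distrib-+ (wt ∘ enum) (λ i → [ i₀ ≟ i ] * w))
        (cong (∑ᵥ wt +_) (trans (∑-single (λ i → [ i₀ ≟ i ] * w) i₀ (λ i≢ → cong (_* w) ([≟]-≢ (i≢ ∘ sym))))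
          (trans (cong (_* w) ([≟]-refl i₀)) (*-identityˡ w))))

      h₀ : V
      h₀ = δ zero

      h₀≉0 : ¬ (h₀ ≋ 0ᵥ)
      h₀≉0 eq = 1≉0 (≈-trans (≈-sym (δ-refl {suc v} zero)) (eq zero))

      w₀ : ℕ
      w₀ = wt h₀

    -- The n points and the zero vector give n + 1 distinct vectors. In dimension at most r this
    -- puts every weight below q^r, so that congruent weights are equal.
    n<q^v : n < q ^ suc v
    n<q^v = Fin.injective⇒≤ {f = code} (λ {i} {j} → code-injective i j)
      where
      code : Fin (suc n) → Fin (q ^ suc v)
      code zero    = index 0ᵥ
      code (suc i) = index (vectors i)
      code-injective : ∀ i j → code i ≡ code j → i ≡ j
      code-injective zero    zero    _  = refl
      code-injective zero    (suc j) eq =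
        contradiction (λ k → ≈-sym (index-injective {x = 0ᵥ} {vectors j} eq k)) (generator≉0 (point j))
      code-injective (suc i) zero    eq = contradiction (index-injective {x = vectors i} {0ᵥ} eq) (generator≉0 (point i))
      code-injective (suc i) (suc j) eq with i Fin.≟ j
      ... | yes i≡j = cong suc i≡j
      ... | no  i≢j = contradiction (index-injective {x = vectors i} {vectors j} eq) (separated⇒≉ (vectors-separated i≢j))

    module _ {r : ℕ} .{{_ : NonZero (q ^ r)}} (C-divisible : Divisible (q ^ r) C) where

      private
        D = q ^ r
        u = proj₁ C-divisible

      wt-u : ∀ {h} → ¬ (h ≋ 0ᵥ) → ⁺ D ∣ℤ (⁺ wt h -ℤ (⁺ n -ℤ u))
      wt-u {h} h≉0
        with k , hk≉0 ← nonzero-coordinate h≉0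
        with m , card , D∣m-u ← proj₂ C-divisible (perp h hk≉0) =
        subst (⁺ D ∣ℤ_) (trans (flip (⁺ m) (⁺ wt h) u) (cong (λ n → ⁺ wt h -ℤ (n -ℤ u)) m+w≡n))
          (Signed.∣⇒∣ᵤ (Signed.∣m⇒∣-m (Signed.∣ᵤ⇒∣ {⁺ D} {⁺ m -ℤ u} D∣m-u)))
        where
        m+w≡n : ⁺ m +ℤ ⁺ wt h ≡ ⁺ n
        m+w≡n = cong ⁺_ (∣C∩perp∣ h hk≉0 card)
        flip : ∀ m w u → -ℤ (m -ℤ u) ≡ w -ℤ ((m +ℤ w) -ℤ u)
        flip = ℤSolver.solve-∀

      wt-%-const : ∀ {h} → ¬ (h ≋ 0ᵥ) → wt h % D ≡ w₀ % D
      wt-%-const {h} h≉0 = ∣-difference⇒%-≡ {u = ⁺ n -ℤ u} (wt-u h≉0) (wt-u h₀≉0)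

      -- Summing over all h, the constant residue w₀ occurs q^(v + 1) - 1 times.
      D∣wt : r ≤ v → ∀ h → D ∣ wt h
      D∣wt r≤v h with h ≋? 0ᵥ
      ... | yes h≋0 = subst (D ∣_) (sym (wt-0 h≋0)) (D ∣0)
      ... | no  h≉0 = m%n≡0⇒n∣m (wt h) D (trans (wt-%-const h≉0) w₀%D≡0)
        where
        open ≡-Reasoning
        padded-% : ∀ i → padded w₀ i % D ≡ w₀ % D
        padded-% = padded-elim (λ w → w % D ≡ w₀ % D) w₀ refl wt-%-const
        -- In dimension v + 1 the first moment keeps the factor q^v after q is cancelled; this is
        -- where r ≤ v enters.
        ∑wt : ∑ᵥ wt ≡ q ^ v * (K * ∑ 1s)
        ∑wt = *-cancelˡ-≡ _ _ q (trans (first-moment vectors vectors-nonzero vectors-separated 1s) (*-assoc q (q ^ v) _))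
        D∣∑wt : D ∣ ∑ᵥ wt
        D∣∑wt = subst (D ∣_) (sym ∑wt) (∣m⇒∣m*n _ (q^m∣q^n q r≤v))
        w₀%D≡0 : w₀ % D ≡ 0
        w₀%D≡0 = begin
          w₀ % D                      ≡⟨ %-remove-+ˡ w₀ D∣∑wt ⟨
          (∑ᵥ wt + w₀) % D            ≡⟨ cong (_% D) (∑-padded w₀) ⟨
          ∑ (padded w₀) % D           ≡⟨ ∑-% D (padded w₀) w₀ padded-% ⟩
          (q ^ suc v * w₀) % D        ≡⟨ n∣m⇒m%n≡0 _ D (∣m⇒∣m*n w₀ (q^m∣q^n q (m≤n⇒m≤1+n r≤v))) ⟩
          0                           ∎

      -- In dimension at most r all weights are below q^r, hence equal; a point
      -- outside C would then see the average weight, which forces weight 0.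
      small⇒whole : suc v ≤ r → 0 < K → 0 < n → IsWholeSpace C
      small⇒whole 1+v≤r 0<K 0<n P
        with all⊎any (λ i → separated⊎proportional (vectors i) (generator≉0 P))
      ... | inj₂ (i , a , eq) = PointSet.resp C (proportional⇒≈ₚ (point i) P eq) (proj₂ (Card.from i))
      ... | inj₁ sep = contradiction Kn≡0 (m<n⇒n≢0 (*-mono-< 0<K 0<n))
        where
        open ≡-Reasoning
        y = generator P
        L = q ^ suc v
        KL≢0 : NonZero (K * L)
        KL≢0 = m*n≢0 K L {{>-nonZero 0<K}} {{m^n≢0 q (suc v)}}
        small : ∀ h → wt h % D ≡ wt h
        small h = m<n⇒m%n≡m (≤-<-trans (wt≤n h) (<-≤-trans n<q^v (^-monoʳ-≤ q 1+v≤r)))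
        wt-const : ∀ {h} → ¬ (h ≋ 0ᵥ) → wt h ≡ w₀
        wt-const {h} h≉0 = trans (sym (small h)) (trans (wt-%-const h≉0) (small h₀))
        padded-const : ∀ i → padded w₀ i ≡ w₀
        padded-const = padded-elim (_≡ w₀) w₀ refl wt-const
        y-nonzero = nonzero⇒dot (generator≉0 P)
        wt-nz : ∀ h → wt h * nz (dot h y) ≡ w₀ * nz (dot h y)
        wt-nz h with h ≋? 0ᵥ
        ... | yes h≋0 = trans (cong (wt h *_) (nz-zero (dot-0ˡ y h≋0)))
                (trans (*-zeroʳ (wt h)) (trans (sym (*-zeroʳ w₀)) (cong (w₀ *_) (sym (nz-zero (dot-0ˡ y h≋0))))))
        ... | no  h≉0 = cong (_* nz (dot h y)) (wt-const h≉0)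
        e₁ : ∀ q w a → q * w * (q * a) ≡ q * q * (w * a)
        e₁ = solve-∀
        e₂ : ∀ K L n → K * K * L * n ≡ K * n * (K * L)
        e₂ = solve-∀
        e₃ : ∀ L q w → L * (q * w) ≡ q * (L * w)
        e₃ = solve-∀
        -- The mean of `wt` over the h not orthogonal to y is w₀ by constancy, and K n / q by
        -- `cross-moment`, as y is separated from every point of C.
        qw₀≡Kn : q * w₀ ≡ K * n
        qw₀≡Kn = *-cancelʳ-≡ _ _ (K * L) {{KL≢0}} (begin
          q * w₀ * (K * L)
            ≡⟨ cong (q * w₀ *_) (count-nz₀ {suc v} {y} {proj₁ y-nonzero} (proj₂ y-nonzero)) ⟨
          q * w₀ * (q * ∑ᵥ (λ h → nz (dot h y)))
            ≡⟨ e₁ q w₀ _ ⟩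
          q * q * (w₀ * ∑ᵥ (λ h → nz (dot h y)))
            ≡⟨ cong (q * q *_) (trans (*-distribˡ-∑ w₀ (λ i → nz (dot (enum i) y)))
                 (∑-cong {L} (λ i → sym (wt-nz (enum i))))) ⟩
          q * q * ∑ᵥ (λ h → wt h * nz (dot h y))
            ≡⟨ cross-moment vectors 1s y {proj₁ y-nonzero} sep (proj₂ y-nonzero) ⟩
          K * K * L * ∑ 1s       ≡⟨ cong (K * K * L *_) ∑1s ⟩
          K * K * L * n          ≡⟨ e₂ K L n ⟩
          K * n * (K * L)        ∎)
        ∑wt : ∑ᵥ wt ≡ L * w₀
        ∑wt = *-cancelˡ-≡ _ _ q (begin
          q * ∑ᵥ wt              ≡⟨ first-moment vectors vectors-nonzero vectors-separated 1s ⟩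
          L * (K * ∑ 1s)         ≡⟨ cong (L *_) (trans (cong (K *_) ∑1s) (sym qw₀≡Kn)) ⟩
          L * (q * w₀)           ≡⟨ e₃ L q w₀ ⟩
          q * (L * w₀)           ∎)
        -- The total is L w₀ by the first moment, yet only the L - 1 nonzero vectors contribute w₀.
        w₀≡0 : w₀ ≡ 0
        w₀≡0 = +-cancelˡ-≡ (∑ᵥ wt) _ _ (begin
          ∑ᵥ wt + w₀             ≡⟨ ∑-padded w₀ ⟨
          ∑ (padded w₀)          ≡⟨ trans (∑-cong {L} padded-const) (∑-const L w₀) ⟩
          L * w₀                 ≡⟨ ∑wt ⟨
          ∑ᵥ wt                  ≡⟨ +-identityʳ _ ⟨
          ∑ᵥ wt + 0              ∎)
        Kn≡0 : K * n ≡ 0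
        Kn≡0 = trans (sym qw₀≡Kn) (trans (cong (q *_) w₀≡0) (*-zeroʳ q))

      -- The dimension is v + 1. If it exceeds r, all weights are multiples of q^r and the moment
      -- argument applies. If not, n ≥ a + 1 makes C nonempty, hence the whole space.
      divisible-set⇒¬gap : ¬ (suc v ≤ r × IsWholeSpace C) → ¬ Gap K r n
      divisible-set⇒¬gap ¬whole g with r ≤? v
      ... | yes r≤v = divisible⇒¬gap vectors vectors-nonzero vectors-separated r 1s (λ _ → refl) (D∣wt r≤v)
                        (subst (Gap K r) (sym ∑1s) g)
      ... | no  r≰v = ¬whole (≰⇒> r≰v , small⇒whole (≰⇒> r≰v) (≤-<-trans z≤n (Gap.b<K g)) 0<n)
        where
        0<n : 0 < n
        0<n = begin-strict
          0                                ≤⟨ z≤n ⟩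
          Gap.a g + 0                      <⟨ +-monoʳ-< (Gap.a g) (s≤s z≤n) ⟩
          Gap.a g + 1                      ≤⟨ m≤m+n _ (Gap.y g) ⟩
          Gap.a g + 1 + Gap.y g            ≤⟨ m≤n+m _ ((Gap.a g * K + Gap.b g) * geo K (suc r)) ⟩
          _                                ≡⟨ Gap.n≡ g ⟨
          n                                ∎
          where open ≤-Reasoning

  -- Constructions

  -- A divisible point set given by one vector per point. Divisibility ranges over all functionals,
  -- zero included, because a nonzero functional on a direct sum may vanish on a summand.
  record System (v n r : ℕ) : Set (c ⊔ˡ ℓ) where
    field
      vector    : Fin n → PG.V F v
      nonzero   : ∀ i → ∃ λ e → ¬ (dot e (vector i) ≈ 0#)
      separated : ∀ {i j} → i ≢ j → Separated (vector i) (vector j)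
      divisible : ∀ h → q ^ r ∣ ∑ (λ i → nz (dot h (vector i)))

  dot-++ : ∀ {m n} h (x : Vector Carrier m) (y : Vector Carrier n) →
           dot h (x ++ y) ≈ dot (λ i → h (i ↑ˡ n)) x +ᶠ dot (λ i → h (m ↑ʳ i)) y
  dot-++ {m} {n} h x y = ≈-trans (sum-split F.+-monoid m (λ i → h i *ᶠ (x ++ y) i))
    (F.+-cong
      (Sumᶠ.sum-cong-≋ {m} (λ i → F.*-congˡ (F.reflexive (VecF.lookup-++ˡ x y i))))
      (Sumᶠ.sum-cong-≋ {n} (λ i → F.*-congˡ (F.reflexive (VecF.lookup-++ʳ x y i)))))

  infixr 5 _⊞_

  -- Placed in complementary subspaces, the two families stay disjoint, and the weight of h is the
  -- sum of the weights of its two restrictions.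
  _⊞_ : ∀ {v₁ n₁ v₂ n₂ r} → System v₁ n₁ r → System v₂ n₂ r → System (v₁ + v₂) (n₁ + n₂) r
  _⊞_ {v₁} {n₁} {v₂} {n₂} {r} S T = record
    { vector    = xs ++ ys
    ; nonzero   = ++-all xs ys {P = λ x → ∃ λ e → ¬ (dot e x ≈ 0#)}
        (λ i → proj₁ (S.nonzero i) ++ 0₂ ,
               λ eq → proj₂ (S.nonzero i) (≈-trans (≈-sym (dot-ˡ (proj₁ (S.nonzero i)) 0₂ i)) eq))
        (λ i → 0₁ ++ proj₁ (T.nonzero i) ,
               λ eq → proj₂ (T.nonzero i) (≈-trans (≈-sym (dot-ʳ 0₁ (proj₁ (T.nonzero i)) i)) eq))
    ; separated = ++-pairwise xs ys {R = Separated}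
        (λ { {i} {j} i≢j → let e , ex≉0 , ey≈0 = S.separated i≢j in e ++ 0₂ ,
               (λ eq → ex≉0 (≈-trans (≈-sym (dot-ˡ e 0₂ i)) eq)) , ≈-trans (dot-ˡ e 0₂ j) ey≈0 })
        (λ { {i} {j} i≢j → let e , ex≉0 , ey≈0 = T.separated i≢j in 0₁ ++ e ,
               (λ eq → ex≉0 (≈-trans (≈-sym (dot-ʳ 0₁ e i)) eq)) , ≈-trans (dot-ʳ 0₁ e j) ey≈0 })
        (λ i j → let e , ex≉0 = S.nonzero i in e ++ 0₂ ,
               (λ eq → ex≉0 (≈-trans (≈-sym (dot-ˡ e 0₂ i)) eq)) , ≈-trans (dot-ʳ e 0₂ j) (dot-0ˡ (T.vector j) (λ _ → ≈-refl)))
        (λ i j → let e , ex≉0 = T.nonzero i in 0₁ ++ e ,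
               (λ eq → ex≉0 (≈-trans (≈-sym (dot-ʳ 0₁ e i)) eq)) , ≈-trans (dot-ˡ 0₁ e j) (dot-0ˡ (S.vector j) (λ _ → ≈-refl)))
    ; divisible = λ h → subst (q ^ r ∣_) (sym (trans (∑-++ (λ x → nz (dot h x)) xs ys)
        (cong₂ _+_ (∑-cong {n₁} (λ i → nz-cong (restrictˡ h i))) (∑-cong {n₂} (λ i → nz-cong (restrictʳ h i))))))
        (∣m∣n⇒∣m+n (S.divisible (λ i → h (i ↑ˡ v₂))) (T.divisible (λ i → h (v₁ ↑ʳ i))))
    }
    where
    module S = System S
    module T = System T
    0₁ = PG.0ᵥ F v₁
    0₂ = PG.0ᵥ F v₂
    xs : Fin n₁ → PG.V F (v₁ + v₂)
    xs i = S.vector i ++ 0₂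
    ys : Fin n₂ → PG.V F (v₁ + v₂)
    ys i = 0₁ ++ T.vector i
    restrictˡ : ∀ h i → dot h (xs i) ≈ dot (λ j → h (j ↑ˡ v₂)) (S.vector i)
    restrictˡ h i = ≈-trans (dot-++ h (S.vector i) 0₂)
      (≈-trans (F.+-congˡ (dot-0ʳ (λ j → h (v₁ ↑ʳ j)) (λ _ → ≈-refl))) (F.+-identityʳ _))
    restrictʳ : ∀ h i → dot h (ys i) ≈ dot (λ j → h (v₁ ↑ʳ j)) (T.vector i)
    restrictʳ h i = ≈-trans (dot-++ h 0₁ (T.vector i))
      (≈-trans (F.+-congʳ (dot-0ʳ (λ j → h (j ↑ˡ v₂)) (λ _ → ≈-refl))) (F.+-identityˡ _))
    dot-ˡ : ∀ e e′ i → dot (e ++ e′) (xs i) ≈ dot e (S.vector i)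
    dot-ˡ e e′ i = ≈-trans (restrictˡ (e ++ e′) i)
      (dot-cong {x = S.vector i} (λ j → F.reflexive (VecF.lookup-++ˡ e e′ j)) (λ _ → ≈-refl))
    dot-ʳ : ∀ e e′ i → dot (e ++ e′) (ys i) ≈ dot e′ (T.vector i)
    dot-ʳ e e′ i = ≈-trans (restrictʳ (e ++ e′) i)
      (dot-cong {x = T.vector i} (λ j → F.reflexive (VecF.lookup-++ʳ e e′ j)) (λ _ → ≈-refl))

  -- The points off the hyperplane where the first coordinate vanishes, each scaled to first
  -- coordinate 1.
  affine : ∀ k → Fin (q ^ k) → PG.V F (suc k)
  affine k i = 1# ∷ enum i

  head-functional : ∀ k → PG.V F (suc k)
  head-functional k = 1# ∷ PG.0ᵥ F k

  dot-head : ∀ {k} a (y : PG.V F k) → dot (head-functional k) (a ∷ y) ≈ a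
  dot-head a y = ≈-trans (F.+-cong (F.*-identityˡ a) (dot-0ˡ y (λ _ → ≈-refl))) (F.+-identityʳ a)

  affine-nonzero : ∀ k i → ∃ λ e → ¬ (dot e (affine k i) ≈ 0#)
  affine-nonzero k i = head-functional k , λ eq → 1≉0 (≈-trans (≈-sym (dot-head {k} 1# (enum i))) eq)

  affine-separated : ∀ k {i j} → i ≢ j → Separated (affine k i) (affine k j)
  affine-separated k {i} {j} i≢j
    with l , x≉y ← Fin.¬∀⟶∃¬ k (λ l → enum {k} i l ≈ enum j l) (λ l → enum {k} i l ≈? enum j l)
           (λ eq → i≢j (trans (sym (index-enum {k} i)) (trans (index-cong {k} eq) (index-enum {k} j)))) =
    -- For points (1, x) and (1, y) with x_l ≠ y_l, this functional takes (1, z) to z_l - y_l.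
    (-ᶠ (enum {k} j l)) ∷ δ l ,
    (λ eq → x≉y (x-y≈0⇒x≈y (≈-trans (F.+-comm _ _) (≈-trans (≈-sym (value i)) eq)))) ,
    ≈-trans (value j) (F.-‿inverseˡ _)
    where
    value : ∀ i → dot ((-ᶠ (enum {k} j l)) ∷ δ l) (affine k i) ≈ -ᶠ (enum {k} j l) +ᶠ enum i l
    value i = F.+-cong (F.*-identityʳ _) (dot-δ l (enum i))

  -- This is `count-nz` with the roles of points and functionals exchanged: the sum runs over the
  -- points, and the tail of h is the fixed vector.
  affine-weight : ∀ k (h : PG.V F (suc (suc k))) → ¬ (tail h ≋ PG.0ᵥ F (suc k)) →
                  ∑ (λ i → nz (dot h (affine (suc k) i))) ≡ K * q ^ k
  affine-weight k h h′≉0 = *-cancelˡ-≡ _ _ q (begin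
    q * ∑ (λ i → nz (dot h (affine (suc k) i)))
      ≡⟨ cong (q *_) (∑-cong {q ^ suc k} (λ i → nz-cong (F.+-cong (F.*-identityʳ (h zero)) (dot-comm (tail h) (enum i))))) ⟩
    q * ∑ᵥ (λ y → nz (h zero +ᶠ dot y (tail h)))
      ≡⟨ count-nz {suc k} {tail h} {proj₁ (nonzero⇒dot h′≉0)} (proj₂ (nonzero⇒dot h′≉0)) (h zero) ⟩
    K * q ^ suc k         ≡⟨ lem K q (q ^ k) ⟩
    q * (K * q ^ k)       ∎)
    where
    open ≡-Reasoning
    lem : ∀ K q p → K * (q * p) ≡ q * (K * p)
    lem = solve-∀

  affine-weight₀ : ∀ k (h : PG.V F (suc k)) → tail h ≋ PG.0ᵥ F k →
                   ∑ (λ i → nz (dot h (affine k i))) ≡ q ^ k * nz (h zero)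
  affine-weight₀ k h h′≋0 = trans
    (∑-cong {q ^ k} (λ i → nz-cong (≈-trans (F.+-cong (F.*-identityʳ (h zero)) (dot-0ˡ (enum i) h′≋0)) (F.+-identityʳ _))))
    (∑-const (q ^ k) (nz (h zero)))

  affine-system : ∀ r → System (2 + r) (q ^ suc r) r
  affine-system r = record
    { vector    = affine (suc r)
    ; nonzero   = affine-nonzero (suc r)
    ; separated = affine-separated (suc r)
    ; divisible = divisible
    }
    where
    divisible : ∀ h → q ^ r ∣ ∑ (λ i → nz (dot h (affine (suc r) i)))
    divisible h with tail h ≋? PG.0ᵥ F (suc r)
    ... | yes h′≋0 = subst (q ^ r ∣_) (sym (affine-weight₀ (suc r) h h′≋0)) (∣m⇒∣m*n _ (n∣m*n q))
    ... | no  h′≉0 = subst (q ^ r ∣_) (sym (affine-weight r h h′≉0)) (n∣m*n K)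

  -- Each point of PG(k - 1, q) is listed by its vector with leading coordinate 1.
  normalized : ∀ k → Fin (geo K k) → PG.V F k
  normalized zero    = λ ()
  normalized (suc k) = affine k ++ (λ i → 0# ∷ normalized k i)

  dot-0∷ : ∀ {k} h (y : PG.V F k) → dot h (0# ∷ y) ≈ dot (tail h) y
  dot-0∷ h y = ≈-trans (F.+-congʳ (F.zeroʳ (h zero))) (F.+-identityˡ _)

  normalized-nonzero : ∀ k i → ∃ λ e → ¬ (dot e (normalized k i) ≈ 0#)
  normalized-nonzero (suc k) = ++-all (affine k) (λ i → 0# ∷ normalized k i)
    {P = λ x → ∃ λ e → ¬ (dot e x ≈ 0#)} (affine-nonzero k)
    (λ i → let e , ey≉0 = normalized-nonzero k i in
      0# ∷ e , λ eq → ey≉0 (≈-trans (≈-sym (dot-0∷ (0# ∷ e) (normalized k i))) eq))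

  normalized-separated : ∀ k {i j} → i ≢ j → Separated (normalized k i) (normalized k j)
  normalized-separated (suc k) = ++-pairwise (affine k) (λ i → 0# ∷ normalized k i) {R = Separated}
    (affine-separated k)
    (λ { {i} {j} i≢j → let e , ex≉0 , ey≈0 = normalized-separated k i≢j in 0# ∷ e ,
          (λ eq → ex≉0 (≈-trans (≈-sym (dot-0∷ (0# ∷ e) (normalized k i))) eq)) ,
          ≈-trans (dot-0∷ (0# ∷ e) (normalized k j)) ey≈0 })
    (λ i j → head-functional k , proj₂ (affine-nonzero k i) , dot-head 0# (normalized k j))
    -- A functional that is nonzero on the point at infinity gets the leading coefficient that makes
    -- it vanish on the affine point.
    (λ i j → let e , ex≉0 = normalized-nonzero k i in (-ᶠ (dot e (enum j))) ∷ e ,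
          (λ eq → ex≉0 (≈-trans (≈-sym (dot-0∷ ((-ᶠ (dot e (enum j))) ∷ e) (normalized k i))) eq)) ,
          ≈-trans (F.+-congʳ (F.*-identityʳ _)) (F.-‿inverseˡ (dot e (enum j))))

  normalized-weight₀ : ∀ k (h : PG.V F k) → h ≋ PG.0ᵥ F k → ∑ (λ i → nz (dot h (normalized k i))) ≡ 0
  normalized-weight₀ k h h≋0 = trans (∑-cong {geo K k} (λ i → nz-zero (dot-0ˡ (normalized k i) h≋0)))
    (trans (∑-const (geo K k) 0) (*-zeroʳ (geo K k)))

  -- If the tail of h vanishes, all q^k affine points count and none at infinity does. Otherwise the
  -- affine part gives K q^(k - 1) and the part at infinity, by recursion, q^(k - 1).
  normalized-weight : ∀ k (h : PG.V F (suc k)) → ¬ (h ≋ PG.0ᵥ F (suc k)) →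
                      ∑ (λ i → nz (dot h (normalized (suc k) i))) ≡ q ^ k
  normalized-weight k h h≉0 = trans (∑-++ (λ x → nz (dot h x)) (affine k) (λ i → 0# ∷ normalized k i))
    (trans (cong (∑ (λ i → nz (dot h (affine k i))) +_)
      (∑-cong {geo K k} (λ i → nz-cong (dot-0∷ h (normalized k i))))) (go k h h≉0 (tail h ≋? PG.0ᵥ F k)))
    where
    go : ∀ k (h : PG.V F (suc k)) → ¬ (h ≋ PG.0ᵥ F (suc k)) → Dec (tail h ≋ PG.0ᵥ F k) →
         ∑ (λ i → nz (dot h (affine k i))) + ∑ (λ i → nz (dot (tail h) (normalized k i))) ≡ q ^ k
    go k h h≉0 (yes h′≋0) = trans
      (cong₂ _+_ (trans (affine-weight₀ k h h′≋0) (cong (q ^ k *_)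
          (nz-nonzero (λ h₀≈0 → h≉0 (λ { zero → h₀≈0 ; (suc i) → h′≋0 i })))))
        (normalized-weight₀ k (tail h) h′≋0))
      (trans (+-identityʳ _) (*-identityʳ _))
    go zero    h h≉0 (no h′≉0) = contradiction (λ ()) h′≉0
    go (suc k) h h≉0 (no h′≉0) = trans
      (cong₂ _+_ (affine-weight k h h′≉0) (normalized-weight k (tail h) h′≉0)) (+-comm (K * q ^ k) (q ^ k))

  projective-system : ∀ r → System (suc r) (geo K (suc r)) r
  projective-system r = record
    { vector    = normalized (suc r)
    ; nonzero   = normalized-nonzero (suc r)
    ; separated = normalized-separated (suc r)
    ; divisible = divisible
    }
    where
    divisible : ∀ h → q ^ r ∣ ∑ (λ i → nz (dot h (normalized (suc r) i)))
    divisible h with h ≋? PG.0ᵥ F (suc r)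
    ... | yes h≋0 = subst (q ^ r ∣_) (sym (normalized-weight₀ (suc r) h h≋0)) (_ ∣0)
    ... | no  h≉0 = subst (q ^ r ∣_) (sym (normalized-weight r h h≉0)) ∣-refl

  empty-system : ∀ v r → System v 0 r
  empty-system v r = record
    { vector = λ () ; nonzero = λ () ; separated = λ { {()} } ; divisible = λ _ → _ ∣0 }

  combined-system : ∀ r A B → ∃ λ v → System (2 + v) (A * geo K (suc r) + B * q ^ suc r) r
  -- The empty set is placed in dimension 2 so that every sum satisfies 2 ≤ v.
  combined-system r zero    zero    = 0 , empty-system 2 r
  combined-system r zero    (suc B) with v , S ← combined-system r zero B =
    r + (2 + v) , affine-system r ⊞ S
  combined-system r (suc A) B with v , S ← combined-system r A B =
    r + suc v , subst₂ (λ v n → System v n r) (cong suc (+-suc r (suc v)))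
      (sym (+-assoc (geo K (suc r)) (A * geo K (suc r)) (B * q ^ suc r))) (projective-system r ⊞ S)

  -- By the pigeonhole principle two of the q^(v + 1) vectors have the same
  -- products with the v given ones.
  common-zero : ∀ {v} → 0 < K → (b : Fin v → PG.V F (suc v)) →
                ∃ λ h → ¬ (h ≋ PG.0ᵥ F (suc v)) × (∀ i → dot h (b i) ≈ 0#)
  common-zero {v} 0<K b
    with k , l , k<l , eq ← Fin.pigeonhole {q ^ v} {q ^ suc v}
           (^-monoʳ-< q (s≤s 0<K) {v} {suc v} ≤-refl) (λ k → index {v} (λ i → dot (enum {suc v} k) (b i))) =
    h , (λ h≋0 → Fin.<⇒≢ k<l (trans (sym (index-enum {suc v} k)) (trans
          (index-cong {suc v} (λ j → x-y≈0⇒x≈y (≈-trans (F.+-congˡ (≈-sym (-1*x≈-x _))) (h≋0 j)))) (index-enum {suc v} l)))) ,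
    λ i → ≈-trans (dot-+·ˡ (enum k) (-ᶠ 1#) (enum l) (b i))
            (≈-trans (F.+-cong (index-injective {v} eq i) (-1*x≈-x _)) (F.-‿inverseʳ _))
    where
    open RingProps ring using (-1*x≈-x)
    open PG F (suc v) using (V; _+ᵥ_; _·ᵥ_)
    h : V
    h = enum k +ᵥ (-ᶠ 1#) ·ᵥ enum l

  -- Normal vectors of hyperplanes

  module _ {v : ℕ} where
    open PG F v

    linComb-mem : ∀ (W : Subspace) {k} a (b : Vector V k) → (∀ i → Mem W (b i)) → Mem W (linComb a b)
    linComb-mem W {zero}  a b b∈W = Subspace.0-mem W
    linComb-mem W {suc k} a b b∈W = Subspace.+-closed W (Subspace.·-closed W (a zero) (b∈W zero))
      (linComb-mem W (tail a) (tail b) (b∈W ∘ suc))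

  module _ {v : ℕ} (0<K : 0 < K) (H : PG.Hyperplane F (suc v)) where
    open PG F (suc v)
    private
      W = proj₁ H
      module D = HasDimension (proj₂ H)

    normal : V
    normal = proj₁ (common-zero 0<K D.basis)

    normal≉0 : ¬ (normal ≋ 0ᵥ)
    normal≉0 = proj₁ (proj₂ (common-zero 0<K D.basis))

    normal-linComb : ∀ a → dot normal (linComb a D.basis) ≈ 0#
    normal-linComb a = ≈-trans (dot-linComb normal a D.basis)
      (≈-trans (Sumᶠ.sum-cong-≋ {v} (λ i → ≈-trans (F.*-congˡ (proj₂ (proj₂ (common-zero 0<K D.basis)) i)) (F.zeroʳ (a i))))
        (Sumᶠ.sum-replicate-zero v))

    mem⇒normal : ∀ {x} → Mem W x → dot normal x ≈ 0#
    mem⇒normal x∈W with a , eq ← D.spanning x∈W =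
      ≈-trans (dot-cong {h = normal} (λ _ → ≈-refl) eq) (normal-linComb a)

    -- A relation between x and the basis exists after deleting one coordinate,
    -- and it survives in that coordinate because both sides are orthogonal to
    -- the normal vector.
    normal⇒mem : ∀ {x} → dot normal x ≈ 0# → Mem W x
    normal⇒mem {x} nx≈0
      with k , nk≉0 ← nonzero-coordinate normal≉0
      with a , a≉0 , az≈0 ← common-zero 0<K (λ j i → (x ∷ D.basis) i (punchIn k j)) = x∈W
      where
      b = tail a
      y = linComb b D.basis
      z : V
      z = linComb a (x ∷ D.basis)
      nz≈0 : dot normal z ≈ 0#
      nz≈0 = ≈-trans (dot-+ʳ normal (a zero ·ᵥ x) y) (≈-trans
        (F.+-cong (≈-trans (dot-·ʳ (a zero) normal x) (≈-trans (F.*-congˡ nx≈0) (F.zeroʳ (a zero)))) (normal-linComb b))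
        (F.+-identityˡ 0#))
      z≋0 : z ≋ 0ᵥ
      z≋0 = perp-ext normal nk≉0 (≈-trans nz≈0 (≈-sym (dot-0ʳ normal (λ _ → ≈-refl)))) az≈0
      a₀≉0 : ¬ (a zero ≈ 0#)
      a₀≉0 a₀≈0 = a≉0 λ { zero → a₀≈0 ; (suc i) → D.independent b (λ j → ≈-trans
        (≈-sym (≈-trans (F.+-congʳ (≈-trans (F.*-congʳ a₀≈0) (F.zeroˡ (x j)))) (F.+-identityˡ (y j)))) (z≋0 j)) i }
      d = proj₁ (inverse (a zero) a₀≉0)
      x≋ : (-ᶠ d) ·ᵥ y ≋ x
      x≋ j = *-cancelˡ-≈ a₀≉0 (begin
        a zero *ᶠ (-ᶠ d *ᶠ y j)      ≈⟨ F.*-congˡ (-‿distribˡ-* d (y j)) ⟨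
        a zero *ᶠ (-ᶠ (d *ᶠ y j))    ≈⟨ -‿distribʳ-* (a zero) _ ⟨
        -ᶠ (a zero *ᶠ (d *ᶠ y j))    ≈⟨ F.-‿cong (≈-sym (·ᵥ-cancel {x = d ·ᵥ y} {y}
                                            (≈-trans (F.*-comm (a zero) d) (proj₂ (inverse (a zero) a₀≉0))) (λ _ → ≈-refl) j)) ⟩
        -ᶠ (y j)                     ≈⟨ +-inverseˡ-unique _ _ (z≋0 j) ⟨
        a zero *ᶠ x j                ∎)
        where
        open SetoidReasoning setoid
        open RingProps ring using (-‿distribˡ-*; -‿distribʳ-*; +-inverseˡ-unique)
      x∈W : Mem W x
      x∈W = Subspace.resp W x≋ (Subspace.·-closed W (-ᶠ d) (linComb-mem W b D.basis D.basis-mem))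

  -- The point set of a system

  module _ {v : ℕ} where
    open PG F v

    span : ∀ x → ¬ (x ≋ 0ᵥ) → Point
    span x x≉0 = record
      { Mem      = λ y → ∃ λ a → y ≋ a ·ᵥ x
      ; resp     = λ y≋z (a , eq) → a , λ j → ≈-trans (≈-sym (y≋z j)) (eq j)
      ; 0-mem    = 0# , λ j → ≈-sym (F.zeroˡ (x j))
      ; +-closed = λ (a , eq) (b , eq′) → a +ᶠ b , λ j → ≈-trans (F.+-cong (eq j) (eq′ j)) (≈-sym (F.distribʳ (x j) a b))
      ; ·-closed = λ d (a , eq) → d *ᶠ a , λ j → ≈-trans (F.*-congˡ (eq j)) (≈-sym (F.*-assoc d a (x j)))
      } , record
      { basis       = λ _ → x
      ; basis-mem   = λ _ → 1# , λ j → ≈-sym (F.*-identityˡ (x j))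
      ; independent = λ { a eq zero → let k , xk≉0 = nonzero-coordinate x≉0 in
          *-cancelˡ-zero xk≉0 (≈-trans (F.*-comm (x k) (a zero)) (≈-trans (≈-sym (F.+-identityʳ _)) (eq k))) }
      ; spanning    = λ (a , eq) → (λ _ → a) , λ j → ≈-trans (eq j) (≈-sym (F.+-identityʳ _))
      }

  module _ {v n r : ℕ} (0<K : 0 < K) (S : System (suc v) n r) where
    open PG F (suc v)
    private module S = System S

    vector≉0 : ∀ i → ¬ (S.vector i ≋ 0ᵥ)
    vector≉0 i eq = proj₂ (S.nonzero i) (dot-0ʳ (proj₁ (S.nonzero i)) eq)

    pointSet : PointSet
    pointSet = record
      { Has  = λ P → ∃ λ i → Mem (proj₁ P) (S.vector i)
      ; resp = λ P≈Q (i , x∈P) → i , proj₁ P≈Q x∈P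
      }

    -- A functional that kills one nonzero vector of a point kills the whole point, so separated
    -- vectors never share one.
    vector-unique : ∀ P {i j} → Mem (proj₁ P) (S.vector i) → Mem (proj₁ P) (S.vector j) → i ≡ j
    vector-unique P {i} {j} x∈P y∈P with i Fin.≟ j
    ... | yes i≡j = i≡j
    ... | no  i≢j
      with e , ex≉0 , ey≈0 ← S.separated i≢j | a , x≋ag ← mem⇒multiple P x∈P | b , y≋bg ← mem⇒multiple P y∈P =
      contradiction (≈-trans (dot-multiple x≋ag) (≈-trans (F.*-congˡ eg≈0) (F.zeroʳ a))) ex≉0
      where
      dot-multiple : ∀ {y d} → y ≋ d ·ᵥ generator P → dot e y ≈ d *ᶠ dot e (generator P)
      dot-multiple {d = d} eq = ≈-trans (dot-cong {h = e} (λ _ → ≈-refl) eq) (dot-·ʳ d e (generator P))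
      eg≈0 : dot e (generator P) ≈ 0#
      eg≈0 = *-cancelˡ-zero (multiple⇒nonzero (vector≉0 j) y≋bg) (≈-trans (≈-sym (dot-multiple y≋bg)) ey≈0)

    span-vector : Fin n → Point
    span-vector i = span (S.vector i) (vector≉0 i)

    span-vector-≈ₚ : ∀ P {i} → Mem (proj₁ P) (S.vector i) → span-vector i ≈ₚ P
    span-vector-≈ₚ P {i} x∈P = proportional⇒≈ₚ (span-vector i) P (proj₂ (mem⇒multiple P x∈P))

    span-vector-mem : ∀ i → Mem (proj₁ (span-vector i)) (S.vector i)
    span-vector-mem i = generator-mem (span-vector i)

    module _ {ℓ′} {I : Fin n → Set ℓ′} (E : Enumeration I) (C : PointSet)
             (C⇒I : ∀ {P} → Has C P → ∃ λ i → Mem (proj₁ P) (S.vector i) × I i)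
             (I⇒C : ∀ {i} → I i → Has C (span-vector i)) where
      private module E = Enumeration E

      -- Serves both cardinalities required: the trivial `I` gives the point set itself, and
      -- orthogonality to a normal vector gives its hyperplane sections.
      enumerated-cardinality : ∣ C ∣≡ E.size
      enumerated-cardinality = record
        { to        = to
        ; from      = from
        ; to-cong   = λ {P} {Q} → to-cong {P} {Q}
        ; from-cong = λ { refl → (λ x → x) , (λ x → x) }
        ; inverse   = (λ {j} {P} P≈ → trans (to-cong {P} {from j} P≈) (to-from j)) ,
                      (λ { {P} refl → from-to P })
        }
        where
        to : Σ Point (Has C) → Fin E.size
        to (P , P∈C) = proj₁ (E.complete (proj₂ (proj₂ (C⇒I {P} P∈C))))
        from : Fin E.size → Σ Point (Has C)
        from j = span-vector (E.elems j) , I⇒C (E.sound j)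
        elems-to : ∀ P → E.elems (to P) ≡ proj₁ (C⇒I (proj₂ P))
        elems-to (P , P∈C) = proj₂ (E.complete (proj₂ (proj₂ (C⇒I {P} P∈C))))
        vector-mem : ∀ P → Mem (proj₁ (proj₁ P)) (S.vector (E.elems (to P)))
        vector-mem P = subst (λ i → Mem (proj₁ (proj₁ P)) (S.vector i)) (sym (elems-to P)) (proj₁ (proj₂ (C⇒I (proj₂ P))))
        to-cong : ∀ {P Q} → proj₁ P ≈ₚ proj₁ Q → to P ≡ to Q
        to-cong {P} {Q} P≈Q = E.injective (vector-unique (proj₁ Q) (proj₁ P≈Q (vector-mem P)) (vector-mem Q))
        to-from : ∀ j → to (from j) ≡ j
        to-from j = E.injective (vector-unique (span-vector (E.elems j)) (vector-mem (from j)) (span-vector-mem (E.elems j)))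
        from-to : ∀ P → span-vector (E.elems (to P)) ≈ₚ proj₁ P
        from-to P = span-vector-≈ₚ (proj₁ P) (vector-mem P)

    ∣pointSet∣ : ∣ pointSet ∣≡ n
    ∣pointSet∣ = enumerated-cardinality
      record { size = n ; elems = λ i → i ; sound = λ _ → tt ; injective = λ eq → eq ; complete = λ {k} _ → k , refl }
      pointSet (λ (i , x∈P) → i , x∈P , tt) (λ {i} _ → i , span-vector-mem i)

    pointSet-divisible : Divisible (q ^ r) pointSet
    -- The residue is u = n: a section has n - w points, where the weight w of the normal vector is
    -- a multiple of q^r.
    pointSet-divisible = ⁺ n , λ H →
      let h = normal 0<K H
          E = enumerate (λ i → dot h (S.vector i) ≈? 0#)
          module E = Enumeration E
          w = ∑ (λ i → nz (dot h (S.vector i)))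
          size≡ : ∑ (λ i → 1 ∸ nz (dot h (S.vector i))) ≡ E.size
          size≡ = ∑-image E.elems _ E.injective
            (λ i → cong (1 ∸_) (nz-zero (E.sound i)))
            (λ k none → cong (1 ∸_) (nz-nonzero (λ eq → none (proj₁ (E.complete eq)) (proj₂ (E.complete eq)))))
          size+w≡n : E.size + w ≡ n
          size+w≡n = trans (cong (_+ w) (sym size≡)) (trans
            (sym (∑-distrib-+ (λ i → 1 ∸ nz (dot h (S.vector i))) (λ i → nz (dot h (S.vector i)))))
            (trans (∑-cong {n} (λ i → m∸n+n≡m (nz≤1 (dot h (S.vector i))))) (trans (∑-const n 1) (*-identityʳ n))))
      in E.size ,
         enumerated-cardinality E (pointSet ∩ H)
           (λ { {P} ((i , x∈P) , P⊆H) → i , x∈P , mem⇒normal 0<K H (P⊆H x∈P) })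
           (λ {i} hx≈0 → (i , span-vector-mem i) , ⊆⇒mem (span-vector i) (proj₁ H) (normal⇒mem 0<K H hx≈0)) ,
         subst (q ^ r ∣_) (trans (trans (sym (m+n∸m≡n E.size w)) (cong (_∸ E.size) size+w≡n))
           (trans (sym (ℤ.∣⊖∣-≤ (m+o≡n⇒m≤n w size+w≡n))) (cong ∣_∣ℤ (sym (ℤ.[+m]-[+n]≡m⊖n E.size n)))))
           (S.divisible h)

theorem5p16 : ∀ {c ℓ ℓ#} (q : ℕ) {{_ : PrimePower q}} (F : FiniteField c ℓ ℓ# q) (r : ℕ) → 1 ≤ r →
    (∀ (v : ℕ) → 2 ≤ v → let open PG F v in
    ∀ (C : PointSet) (n : ℕ) → Divisible (q ^ r) C → ∣ C ∣≡ n →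
    ¬ (v ≤ r × IsWholeSpace C) →
    ∀ (a b : ℕ) → b ≤ q ∸ 2 → a ≤ r ∸ 1 →
    ¬ (n ∈[ (a * (q ∸ 1) + b) * ([ r + 1 ,1] q) + a + 1
    , (a * (q ∸ 1) + b + 1) * ([ r + 1 ,1] q) ∸ 1 ]))
    ×
    (∀ (n : ℕ) → n ≤ r * q ^ (r + 1) →
    (∀ (a b : ℕ) → b ≤ q ∸ 2 → a ≤ r ∸ 1 →
    ¬ (n ∈[ (a * (q ∸ 1) + b) * ([ r + 1 ,1] q) + a + 1
    , (a * (q ∸ 1) + b + 1) * ([ r + 1 ,1] q) ∸ 1 ])) →
    Σ ℕ λ v → 2 ≤ v × (let open PG F v in
    Σ PointSet λ C → Divisible (q ^ r) C × (∣ C ∣≡ n)))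
theorem5p16 zero          {{pp}} with () ← primePower⇒1<q pp
theorem5p16 (suc zero)    {{pp}} with s≤s () ← primePower⇒1<q pp
-- Writing q as k + 2 and r as a successor makes `q ∸ 1`, `q ∸ 2` and `r ∸ 1` compute without
-- truncation.
theorem5p16 {c} {ℓ} (suc (suc k)) F (suc r) 1≤r = nonexistence , existence
  where
  q = suc (suc k)
  open FiniteFields F using (System; combined-system; divisible-set⇒¬gap; pointSet; pointSet-divisible; ∣pointSet∣)

  Q≡ : [ suc r + 1 ,1] q ≡ geo (suc k) (2 + r)
  Q≡ = trans (geo-quotient k (suc r + 1)) (cong (geo (suc k)) (+-comm (suc r) 1))

  Interval : ℕ → ℕ → ℕ → ℕ → Set
  Interval n a b Q = n ∈[ (a * suc k + b) * Q + a + 1 , (a * suc k + b + 1) * Q ∸ 1 ]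

  nonexistence : _
  nonexistence (suc v) 2≤v C n C-divisible ∣C∣≡n ¬whole a b b≤ a≤ n∈ =
    divisible-set⇒¬gap C ∣C∣≡n {suc r} {{m^n≢0 q (suc r)}} C-divisible ¬whole
      (interval⇒gap {k} {suc r} {n} {a} b≤ (s≤s a≤) (subst (Interval n a b) Q≡ n∈))

  existence : _
  existence n n≤ n∉ with A , B , n≡ ← ¬gap⇒combination {k} {suc r}
      (subst (λ s → n ≤ suc r * q ^ s) (+-comm (suc r) 1) n≤)
      (λ g → n∉ (Gap.a g) (Gap.b g) (s≤s⁻¹ (Gap.b<K g)) (s≤s⁻¹ (Gap.a<r g))
        (subst (Interval n (Gap.a g) (Gap.b g)) (sym Q≡) (gap⇒interval g)))
    with v , S ← subst (λ n → ∃ λ v → System (2 + v) n (suc r)) (sym n≡) (combined-system (suc r) A B) =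
    2 + v , s≤s (s≤s z≤n) , pointSet (s≤s z≤n) S , pointSet-divisible (s≤s z≤n) S , ∣pointSet∣ (s≤s z≤n) S
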